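{- Let $M=(E,\mathcal{I})$ be a matroid with rank $r_M(E)\geq 2$ and let $t$ be a positive integer. If there is a flat $F$ of $M$ satisfying $|E|-|F|<t\,(r_M(E)-r_M(F))$, then $ar(M,t)=|E|$. Otherwise, $$ar(M,t)=\max_{F\colon r_M(F)\leq r_M(E)-2}\{|F|+t\,(r_M(E)-r_M(F)-1)\},$$ where the maximum is taken over all flats $F$ of $M$ with $r_M(F)\leq r_M(E)-2$.
   Context: All matroids have finite ground sets. $r_M(S)$ denotes the rank of $S\subseteq E$ (maximum size of an independent subset of $S$). The closure of $S$ is $cl(S)=\{x\in E: r_M(S\cup\{x\})=r_M(S)\}$, and a flat is a set $F$ with $cl(F)=F$. A coloring of $E$ assigns a color to every element of $E$. A rainbow basis is a basis of $M$ whose elements receive pairwise different colors. Bases $B_1,\dots,B_t$ are pairwise disjoint if they are pairwise disjoint as subsets of $E$. The anti-Ramsey number $ar(M,t)$ is the maximum number $m$ such that there exists a coloring of $E$ using exactly $m$ colors which contains no $t$ pairwise disjoint rainbow bases. -}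

module Defs where

open import Data.Nat using (ℕ; zero; suc; _+_; _*_; _∸_; _≤_; _<_; _⊔_)
open import Data.Bool using (Bool; true; false; if_then_else_)
open import Data.Fin using (Fin)
open import Data.Fin.Subset using (Subset; _∈_; _∉_; _⊆_; _∪_; ⁅_⁆; ∣_∣; ⊥; ⊤; inside; outside)
open import Data.Fin.Subset.Properties using (_⊆?_)
open import Data.Vec using (_∷_; [])
open import Data.List using (List; []; _∷_; map; _++_; foldr)
open import Data.Product using (Σ; ∃; _×_)
open import Relation.Nullary using (¬_; does)
open import Relation.Binary.PropositionalEquality using (_≡_; _≢_)
open import Function.Definitions using (Surjective)

record Matroid (n : ℕ) : Set where
  field
    indep : Subset n → Bool
  Independent : Subset n → Set
  Independent S = indep S ≡ true
  field
    indep-empty : Independent ⊥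
    indep-down  : ∀ {I J} → Independent J → I ⊆ J → Independent I
    indep-aug   : ∀ {I J} → Independent I → Independent J → ∣ I ∣ < ∣ J ∣ →
                  ∃ λ x → x ∈ J × x ∉ I × Independent (I ∪ ⁅ x ⁆)

open Matroid public

allSubsets : (n : ℕ) → List (Subset n)
allSubsets zero = [] ∷ []
allSubsets (suc n) = map (outside ∷_) (allSubsets n) ++ map (inside ∷_) (allSubsets n)

rank : ∀ {n} → Matroid n → Subset n → ℕ
rank {n} M S = foldr step 0 (allSubsets n)
  where
  step : Subset n → ℕ → ℕ
  step T acc = if does (T ⊆? S) then (if indep M T then ∣ T ∣ ⊔ acc else acc) else acc

-- F is a flat: cl(F) = F, where cl(S) = { x : r(S ∪ {x}) = r(S) }.
-- (F ⊆ cl(F) always holds, so we require cl(F) ⊆ F.)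
IsFlat : ∀ {n} → Matroid n → Subset n → Set
IsFlat M F = ∀ x → rank M (F ∪ ⁅ x ⁆) ≡ rank M F → x ∈ F

IsBasis : ∀ {n} → Matroid n → Subset n → Set
IsBasis M B = Independent M B × (∀ x → x ∉ B → ¬ Independent M (B ∪ ⁅ x ⁆))

IsRainbow : ∀ {n m} → (Fin n → Fin m) → Subset n → Set
IsRainbow c B = ∀ x y → x ∈ B → y ∈ B → c x ≡ c y → x ≡ y

HasDisjointRainbowBases : ∀ {n m} → Matroid n → ℕ → (Fin n → Fin m) → Set
HasDisjointRainbowBases M t c =
  Σ (Fin t → Subset _) λ B →
    (∀ i → IsBasis M (B i) × IsRainbow c (B i)) ×
    (∀ i j → i ≢ j → ∀ x → x ∈ B i → x ∈ B j → Data.Empty.⊥)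
  where import Data.Empty

GoodColoring : ∀ {n} → Matroid n → ℕ → (m : ℕ) → Set
GoodColoring {n} M t m =
  Σ (Fin n → Fin m) λ c → Surjective _≡_ _≡_ c × ¬ HasDisjointRainbowBases M t c

ArIs : ∀ {n} → Matroid n → ℕ → ℕ → Set
ArIs M t m = GoodColoring M t m × (∀ k → GoodColoring M t k → k ≤ m)

MaxFlatValue : ∀ {n} → Matroid n → ℕ → ℕ → Set
MaxFlatValue M t m =
  (∃ λ F → IsFlat M F × rank M F ≤ rank M ⊤ ∸ 2 ×
           m ≡ ∣ F ∣ + t * (rank M ⊤ ∸ rank M F ∸ 1)) ×
  (∀ F → IsFlat M F → rank M F ≤ rank M ⊤ ∸ 2 →
           ∣ F ∣ + t * (rank M ⊤ ∸ rank M F ∸ 1) ≤ m)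

SparseFlat : ∀ {n} → Matroid n → ℕ → Set
SparseFlat {n} M t = ∃ λ F → IsFlat M F × n ∸ ∣ F ∣ < t * (rank M ⊤ ∸ rank M F)

{-# OPTIONS --safe #-}
module Submission where

-- Lower bounds: if F is sparse, t disjoint bases would need more than |E| - |F| elements outside F.
-- Otherwise, for a flat F with r(F) ≤ r - 2, give F and t (r - r(F) - 1) - 1 further elements private
-- colours and the rest one common colour: a rainbow basis has at least r - r(F) - 1 elements among
-- those further ones, too many for t disjoint rainbow bases.
--
-- Upper bound: call A packable if t r ≤ t r(S) + |A \ S| for all S; by Rado's argument A then contains
-- t disjoint bases.  Starting from A = E, delete elements whose colour occurs elsewhere in A as long as
-- A stays packable.  When this stops, every element of a repeated colour is avoided by a tight set, and
-- as tight sets are closed under intersection, some tight F avoids all of them.  Counting colours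
-- against F shows that deleting a set D of fewer than t elements makes the colours of A distinct.  Given
-- t disjoint bases in A, one of them misses D.  Either it repeats the colour of some x in D, and is
-- already rainbow; or a symmetric exchange with another basis brings some x in D into it and keeps it
-- rainbow.  Split it off, drop x from D and continue with t - 1 bases.

open import Defs
open import Data.Bool using (true; false; if_then_else_)
open import Data.Empty using () renaming (⊥ to Absurd)
open import Data.Fin using (Fin; zero; suc; punchIn; punchOut; _≟_)
open import Data.Fin.Properties using (suc-injective; any?; all?; punchIn-injective; punchInᵢ≢i; punchIn-punchOut)
open import Data.Fin.Subset using (Subset; _∈_; _∉_; _⊆_; _⊂_; _∪_; _∩_; _─_; _-_; ⁅_⁆; ∣_∣; ⊥; ⊤; ∁; inside; outside; Empty; Nonempty)
open import Data.Fin.Subset.Induction using (⊂-wellFounded; ⊃-wellFounded)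
open import Data.Fin.Subset.Properties
open import Data.List using ([]; _∷_; foldr; map)
open import Data.List.Membership.Propositional using () renaming (_∈_ to _∈ˡ_)
open import Data.List.Membership.Propositional.Properties using (∈-++⁺ˡ; ∈-++⁺ʳ; ∈-map⁺)
open import Data.List.Relation.Unary.Any using (here; there)
open import Data.Nat using (ℕ; zero; suc; _+_; _*_; _∸_; _≤_; _<_; _⊔_; z≤n; s≤s)
open import Data.Nat.Induction using (<-wellFounded)
open import Data.Nat.Properties hiding (suc-injective) renaming (_≟_ to _≟ℕ_)
open import Data.Product using (∃; _×_; _,_; proj₁; proj₂)
open import Data.Sum using (_⊎_; inj₁; inj₂; [_,_]′)
open import Data.Vec using ([]; _∷_; here; there; tabulate)
open import Data.Vec.Properties using (lookup∘tabulate; lookup⇒[]=; []=⇒lookup)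
open import Function using (_∘_; id)
open import Induction.WellFounded using (Acc; acc)
open import Relation.Binary.PropositionalEquality using (_≡_; _≢_; refl; sym; trans; cong; cong₂; subst)
open import Relation.Nullary using (¬_; Dec; yes; no; does; contradiction)
open import Relation.Nullary.Decidable using (¬?; _×-dec_; _→-dec_; dec-true; decidable-stable)
open import Algebra.Properties.CommutativeMonoid.Sum +-0-commutativeMonoid using (sum; ∑-distrib-+)
open import Algebra.Properties.CommutativeSemigroup +-commutativeSemigroup using (interchange)

-- Finite subsets and their cardinalities

x∈p─q⇒x∉q : ∀ {n} {x} (p q : Subset n) → x ∈ p ─ q → x ∉ q
x∈p─q⇒x∉q (_ ∷ p) (inside ∷ q) () here
x∈p─q⇒x∉q (_ ∷ p) (_ ∷ q) (there x∈) (there x∈q) = x∈p─q⇒x∉q p q x∈ x∈q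

x∈p-y⇒x≢y : ∀ {n} {x y} (p : Subset n) → x ∈ p - y → x ≢ y
x∈p-y⇒x≢y {x = x} p x∈ refl = x∈p─q⇒x∉q p ⁅ x ⁆ x∈ (x∈⁅x⁆ x)

∣p∪q∣+∣p∩q∣≡∣p∣+∣q∣ : ∀ {n} (p q : Subset n) → ∣ p ∪ q ∣ + ∣ p ∩ q ∣ ≡ ∣ p ∣ + ∣ q ∣
∣p∪q∣+∣p∩q∣≡∣p∣+∣q∣ [] [] = refl
∣p∪q∣+∣p∩q∣≡∣p∣+∣q∣ (outside ∷ p) (outside ∷ q) = ∣p∪q∣+∣p∩q∣≡∣p∣+∣q∣ p q
∣p∪q∣+∣p∩q∣≡∣p∣+∣q∣ (inside ∷ p) (outside ∷ q) = cong suc (∣p∪q∣+∣p∩q∣≡∣p∣+∣q∣ p q)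
∣p∪q∣+∣p∩q∣≡∣p∣+∣q∣ (outside ∷ p) (inside ∷ q) =
  trans (cong suc (∣p∪q∣+∣p∩q∣≡∣p∣+∣q∣ p q)) (sym (+-suc ∣ p ∣ ∣ q ∣))
∣p∪q∣+∣p∩q∣≡∣p∣+∣q∣ (inside ∷ p) (inside ∷ q) = cong suc
  (trans (+-suc ∣ p ∪ q ∣ ∣ p ∩ q ∣)
    (trans (cong suc (∣p∪q∣+∣p∩q∣≡∣p∣+∣q∣ p q)) (sym (+-suc ∣ p ∣ ∣ q ∣))))

module _ {n : ℕ} {u v p q : Subset n} where

  -- Inclusion-exclusion on both sides, as `u ∪ v` lies in `p ∪ q` and `u ∩ v` in `p ∩ q`. The
  -- modular, subadditive and disjoint estimates used later are all instances.
  ∣u∣+∣v∣≤∣p∣+∣q∣ : (∀ {x} → x ∈ u → x ∈ v → x ∈ p × x ∈ q) → u ⊆ p ∪ q → v ⊆ p ∪ q →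
                   ∣ u ∣ + ∣ v ∣ ≤ ∣ p ∣ + ∣ q ∣
  ∣u∣+∣v∣≤∣p∣+∣q∣ both u⊆ v⊆ = begin
    ∣ u ∣ + ∣ v ∣          ≡⟨ ∣p∪q∣+∣p∩q∣≡∣p∣+∣q∣ u v ⟨
    ∣ u ∪ v ∣ + ∣ u ∩ v ∣  ≤⟨ +-mono-≤ (p⊆q⇒∣p∣≤∣q∣ λ x∈ → [ u⊆ , v⊆ ]′ (x∈p∪q⁻ u v x∈))
                                (p⊆q⇒∣p∣≤∣q∣ λ x∈ → let (a , b) = x∈p∩q⁻ u v x∈ in x∈p∩q⁺ (both a b)) ⟩
    ∣ p ∪ q ∣ + ∣ p ∩ q ∣  ≡⟨ ∣p∪q∣+∣p∩q∣≡∣p∣+∣q∣ p q ⟩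
    ∣ p ∣ + ∣ q ∣          ∎
    where open ≤-Reasoning

∣u∣≤∣p∣+∣q∣ : ∀ {n} {u p q : Subset n} → u ⊆ p ∪ q → ∣ u ∣ ≤ ∣ p ∣ + ∣ q ∣
∣u∣≤∣p∣+∣q∣ {u = u} u⊆ = ≤-trans (m≤m+n ∣ u ∣ _)
  (∣u∣+∣v∣≤∣p∣+∣q∣ {v = ⊥} (λ _ x∈⊥ → contradiction x∈⊥ ∉⊥) u⊆ (λ x∈⊥ → contradiction x∈⊥ ∉⊥))

∣u∣+∣v∣≤∣p∣ : ∀ {n} {u v p : Subset n} → (∀ {x} → x ∈ u → x ∉ v) → u ⊆ p → v ⊆ p →
             ∣ u ∣ + ∣ v ∣ ≤ ∣ p ∣
∣u∣+∣v∣≤∣p∣ {n} {p = p} disj u⊆ v⊆ = ≤-trans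
  (∣u∣+∣v∣≤∣p∣+∣q∣ {p = p} {q = ⊥} (λ a b → contradiction b (disj a)) (p⊆p∪q ⊥ ∘ u⊆) (p⊆p∪q ⊥ ∘ v⊆))
  (≤-reflexive (trans (cong (∣ p ∣ +_) (∣⊥∣≡0 n)) (+-identityʳ _)))

p⊂p∪⁅x⁆ : ∀ {n} {p : Subset n} {x} → x ∉ p → p ⊂ p ∪ ⁅ x ⁆
p⊂p∪⁅x⁆ {p = p} {x} x∉p = p⊆p∪q ⁅ x ⁆ , x , q⊆p∪q p ⁅ x ⁆ (x∈⁅x⁆ x) , x∉p

p⊆p-x∪⁅x⁆ : ∀ {n} (p : Subset n) x → p ⊆ (p - x) ∪ ⁅ x ⁆
p⊆p-x∪⁅x⁆ p x {y} y∈p with y ≟ x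
... | yes refl = q⊆p∪q (p - x) ⁅ x ⁆ (x∈⁅x⁆ x)
... | no y≢x = p⊆p∪q ⁅ x ⁆ (x∈p∧x≢y⇒x∈p-y y∈p y≢x)

p⊆q∪p─q : ∀ {n} (p q : Subset n) → p ⊆ q ∪ (p ─ q)
p⊆q∪p─q p q {x} x∈p with x ∈? q
... | yes x∈q = p⊆p∪q (p ─ q) x∈q
... | no x∉q = q⊆p∪q q (p ─ q) (x∈p∧x∉q⇒x∈p─q x∈p x∉q)

p⊆p∩q∪p∩∁q : ∀ {n} (p q : Subset n) → p ⊆ (p ∩ q) ∪ (p ∩ ∁ q)
p⊆p∩q∪p∩∁q p q {x} x∈p with x ∈? q
... | yes x∈q = p⊆p∪q _ (x∈p∩q⁺ (x∈p , x∈q))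
... | no x∉q = q⊆p∪q (p ∩ q) _ (x∈p∩q⁺ (x∈p , x∉p⇒x∈∁p x∉q))

p∩∁q⊆p─[q∪r]∪p∩r : ∀ {n} (p q r : Subset n) → p ∩ ∁ q ⊆ (p ─ q ∪ r) ∪ (p ∩ r)
p∩∁q⊆p─[q∪r]∪p∩r p q r {x} x∈ with x∈p∩q⁻ p (∁ q) x∈ | x ∈? r
... | x∈p , _ | yes x∈r = q⊆p∪q (p ─ q ∪ r) _ (x∈p∩q⁺ (x∈p , x∈r))
... | x∈p , x∈∁q | no x∉r = p⊆p∪q _ (x∈p∧x∉q⇒x∈p─q x∈p λ x∈q∪r → [ x∈∁p⇒x∉p x∈∁q , x∉r ]′ (x∈p∪q⁻ q r x∈q∪r))

∣p∣≤1+∣p-x∣ : ∀ {n} (p : Subset n) x → ∣ p ∣ ≤ suc ∣ p - x ∣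
∣p∣≤1+∣p-x∣ p x = ≤-trans (∣u∣≤∣p∣+∣q∣ (p⊆p-x∪⁅x⁆ p x))
  (≤-reflexive (trans (cong (∣ p - x ∣ +_) (∣⁅x⁆∣≡1 x)) (+-comm _ 1)))

x∉p⇒1+∣p∣≤∣p∪⁅x⁆∣ : ∀ {n} {p : Subset n} {x} → x ∉ p → suc ∣ p ∣ ≤ ∣ p ∪ ⁅ x ⁆ ∣
x∉p⇒1+∣p∣≤∣p∪⁅x⁆∣ {p = p} {x} x∉p = subst (λ k → k + ∣ p ∣ ≤ ∣ p ∪ ⁅ x ⁆ ∣) (∣⁅x⁆∣≡1 x)
  (∣u∣+∣v∣≤∣p∣ (λ y∈ y∈p → x∉p (subst (_∈ p) (x∈⁅y⁆⇒x≡y x y∈) y∈p)) (q⊆p∪q p ⁅ x ⁆) (p⊆p∪q ⁅ x ⁆))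

⊆∧∣∣≥⇒⊇ : ∀ {n} {p q : Subset n} → p ⊆ q → ∣ q ∣ ≤ ∣ p ∣ → q ⊆ p
⊆∧∣∣≥⇒⊇ {p = p} p⊆q q≤p {x} x∈q with x ∈? p
... | yes x∈p = x∈p
... | no x∉p = contradiction q≤p (<⇒≱ (p⊂q⇒∣p∣<∣q∣ (p⊆q , x , x∈q , x∉p)))

empty⇒∣p∣≡0 : ∀ {n} {p : Subset n} → Empty p → ∣ p ∣ ≡ 0
empty⇒∣p∣≡0 {n} empty = trans (cong ∣_∣ (Empty-unique empty)) (∣⊥∣≡0 n)

all-equal⇒∣p∣≤1 : ∀ {n} (p : Subset n) → (∀ {x y} → x ∈ p → y ∈ p → x ≡ y) → ∣ p ∣ ≤ 1
all-equal⇒∣p∣≤1 p eq with nonempty? p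
... | yes (x , x∈p) = subst (∣ p ∣ ≤_) (∣⁅x⁆∣≡1 x)
  (p⊆q⇒∣p∣≤∣q∣ λ y∈p → subst (_∈ ⁅ x ⁆) (eq x∈p y∈p) (x∈⁅x⁆ x))
... | no empty = subst (_≤ 1) (sym (empty⇒∣p∣≡0 empty)) z≤n

nonempty⇒1≤ : ∀ {n} (p : Subset n) → Nonempty p → 1 ≤ ∣ p ∣
nonempty⇒1≤ p (x , x∈p) = ≤-trans (s≤s z≤n) (x∈p⇒∣p-x∣<∣p∣ x∈p)

∃-subset-of-size : ∀ {n} k (p : Subset n) → k ≤ ∣ p ∣ → ∃ λ q → q ⊆ p × ∣ q ∣ ≡ k
∃-subset-of-size {n} zero p _ = ⊥ , (λ x∈ → contradiction x∈ ∉⊥) , ∣⊥∣≡0 n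
∃-subset-of-size (suc k) (outside ∷ p) k≤ =
  let (q , q⊆p , eq) = ∃-subset-of-size (suc k) p k≤ in outside ∷ q , out⊆ q⊆p , eq
∃-subset-of-size (suc k) (inside ∷ p) (s≤s k≤) =
  let (q , q⊆p , eq) = ∃-subset-of-size k p k≤ in inside ∷ q , in⊆in q⊆p , cong suc eq

module _ {n : ℕ} {P : Fin n → Set} (P? : ∀ x → Dec (P x)) where

  comprehension : Subset n
  comprehension = tabulate (does ∘ P?)

  ∈-comprehension⁺ : ∀ {x} → P x → x ∈ comprehension
  ∈-comprehension⁺ {x} px = lookup⇒[]= x comprehension (trans (lookup∘tabulate (does ∘ P?) x) (dec-true (P? x) px))

  ∈-comprehension⁻ : ∀ {x} → x ∈ comprehension → P x
  ∈-comprehension⁻ {x} x∈ with P? x | trans (sym (lookup∘tabulate (does ∘ P?) x)) ([]=⇒lookup x∈)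
  ... | yes px | _ = px
  ... | no _ | ()

∀-or-∃¬ : ∀ {n} {P : Subset n → Set} → (∀ S → Dec (P S)) → (∀ S → P S) ⊎ ∃ λ S → ¬ P S
∀-or-∃¬ P? with anySubset? (λ S → ¬? (P? S))
... | yes found = inj₂ found
... | no none = inj₁ λ S → decidable-stable (P? S) λ ¬p → none (S , ¬p)

-- Disjoint families and counting

Disjoint : ∀ {n t} → (Fin t → Subset n) → Set
Disjoint B = ∀ i j → i ≢ j → ∀ x → x ∈ B i → x ∈ B j → Absurd

-- Removing `B zero` from `X` costs at least `m` elements and leaves the traces of the other sets
-- intact.
disjoint⇒t*m≤∣X∣ : ∀ {n} t (B : Fin t → Subset n) (X : Subset n) m → Disjoint B →
                  (∀ i → m ≤ ∣ B i ∩ X ∣) → t * m ≤ ∣ X ∣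
disjoint⇒t*m≤∣X∣ zero B X m disj m≤ = z≤n
disjoint⇒t*m≤∣X∣ (suc t) B X m disj m≤ = begin
  m + t * m                          ≤⟨ +-mono-≤ (m≤ zero) (disjoint⇒t*m≤∣X∣ t (B ∘ suc) (X ─ B zero) m
                                          (λ i j i≢j → disj (suc i) (suc j) (i≢j ∘ suc-injective))
                                          λ i → ≤-trans (m≤ (suc i)) (p⊆q⇒∣p∣≤∣q∣ (shrink i))) ⟩
  ∣ B zero ∩ X ∣ + ∣ X ─ B zero ∣    ≤⟨ ∣u∣+∣v∣≤∣p∣ (λ a b → x∈p─q⇒x∉q X (B zero) b (proj₁ (x∈p∩q⁻ (B zero) X a)))
                                          (p∩q⊆q (B zero) X) (p─q⊆p X (B zero)) ⟩
  ∣ X ∣ ∎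
  where
  open ≤-Reasoning
  shrink : ∀ i → B (suc i) ∩ X ⊆ B (suc i) ∩ (X ─ B zero)
  shrink i {x} x∈ = let (a , b) = x∈p∩q⁻ (B (suc i)) X x∈ in
    x∈p∩q⁺ (a , x∈p∧x∉q⇒x∈p─q b (λ x∈₀ → disj zero (suc i) (λ ()) x x∈₀ a))

-- The singletons of the values are `k` disjoint sets, each meeting `X` in one element.
injective⇒k≤∣X∣ : ∀ {n k} (f : Fin k → Fin n) (X : Subset n) → (∀ {i j} → f i ≡ f j → i ≡ j) →
                 (∀ i → f i ∈ X) → k ≤ ∣ X ∣
injective⇒k≤∣X∣ {k = k} f X inj f∈ = subst (_≤ ∣ X ∣) (*-identityʳ k)
  (disjoint⇒t*m≤∣X∣ k (λ i → ⁅ f i ⁆) X 1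
    (λ i j i≢j x a b → i≢j (inj (trans (sym (x∈⁅y⁆⇒x≡y (f i) a)) (x∈⁅y⁆⇒x≡y (f j) b))))
    λ i → subst (_≤ ∣ ⁅ f i ⁆ ∩ X ∣) (∣⁅x⁆∣≡1 (f i)) (p⊆q⇒∣p∣≤∣q∣ λ {x} x∈ →
      x∈p∩q⁺ (x∈ , subst (_∈ X) (sym (x∈⁅y⁆⇒x≡y (f i) x∈)) (f∈ i))))

-- Finite sums

sum-mono : ∀ {t} {f g : Fin t → ℕ} → (∀ i → f i ≤ g i) → sum f ≤ sum g
sum-mono {zero} f≤g = z≤n
sum-mono {suc t} f≤g = +-mono-≤ (f≤g zero) (sum-mono (f≤g ∘ suc))

sum-mono-< : ∀ {t} {f g : Fin t → ℕ} → (∀ i → f i ≤ g i) → ∀ i → f i < g i → sum f < sum g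
sum-mono-< f≤g zero f<g = +-mono-<-≤ f<g (sum-mono (f≤g ∘ suc))
sum-mono-< f≤g (suc i) f<g = +-mono-≤-< (f≤g zero) (sum-mono-< (f≤g ∘ suc) i f<g)

sum-const : ∀ t m → sum {t} (λ _ → m) ≡ t * m
sum-const zero m = refl
sum-const (suc t) m = cong (m +_) (sum-const t m)

sum-zero : ∀ {t} {f : Fin t → ℕ} → (∀ i → f i ≤ 0) → sum f ≤ 0
sum-zero {t} f≤0 = ≤-trans (sum-mono f≤0) (≤-reflexive (trans (sum-const t 0) (*-zeroʳ t)))

sum-single : ∀ {t} (f : Fin t → ℕ) i → (∀ l → l ≢ i → f l ≤ 0) → sum f ≤ f i
sum-single f zero f≤0 = ≤-trans (+-monoʳ-≤ (f zero) (sum-zero λ l → f≤0 (suc l) λ ()))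
  (≤-reflexive (+-identityʳ (f zero)))
sum-single f (suc i) f≤0 = +-mono-≤ (f≤0 zero λ ()) (sum-single (f ∘ suc) i λ l l≢i → f≤0 (suc l) (l≢i ∘ suc-injective))

-- No slack is left: a term below `m` could not be made up by the others. This later forces every
-- part of a cover to be a basis.
t*m≤sum⇒m≤f : ∀ {t m} (f : Fin t → ℕ) → (∀ i → f i ≤ m) → t * m ≤ sum f → ∀ i → m ≤ f i
t*m≤sum⇒m≤f {suc t} {m} f f≤m le zero = +-cancelʳ-≤ (t * m) m (f zero) (≤-trans le
  (+-monoʳ-≤ (f zero) (≤-trans (sum-mono (f≤m ∘ suc)) (≤-reflexive (sum-const t m)))))
t*m≤sum⇒m≤f {suc t} {m} f f≤m le (suc i) = t*m≤sum⇒m≤f (f ∘ suc) (f≤m ∘ suc)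
  (+-cancelˡ-≤ m _ _ (≤-trans le (+-monoˡ-≤ _ (f≤m zero)))) i

cover⇒∣A∣≤sum : ∀ {n t} (I : Fin t → Subset n) (A : Subset n) → (∀ {x} → x ∈ A → ∃ λ i → x ∈ I i) →
               ∣ A ∣ ≤ sum (λ i → ∣ I i ∣)
cover⇒∣A∣≤sum {t = zero} I A cov = ≤-reflexive (empty⇒∣p∣≡0 {p = A} no-element)
  where
  no-element : Empty A
  no-element (_ , x∈A) with cov x∈A
  ... | () , _
cover⇒∣A∣≤sum {t = suc t} I A cov = ≤-trans (∣u∣≤∣p∣+∣q∣ (p⊆q∪p─q A (I zero)))
  (+-monoʳ-≤ ∣ I zero ∣ (cover⇒∣A∣≤sum (I ∘ suc) (A ─ I zero) cov′))
  where
  cov′ : ∀ {x} → x ∈ A ─ I zero → ∃ λ i → x ∈ I (suc i)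
  cov′ x∈ with cov (p─q⊆p A (I zero) x∈)
  ... | zero , x∈₀ = contradiction x∈₀ (x∈p─q⇒x∉q A (I zero) x∈)
  ... | suc i , x∈ᵢ = i , x∈ᵢ

-- Listing subsets, maximising over them, colouring by them

∈-allSubsets : ∀ {n} (S : Subset n) → S ∈ˡ allSubsets n
∈-allSubsets [] = here refl
∈-allSubsets (outside ∷ S) = ∈-++⁺ˡ (∈-map⁺ (outside ∷_) (∈-allSubsets S))
∈-allSubsets {suc n} (inside ∷ S) =
  ∈-++⁺ʳ (map (outside ∷_) (allSubsets n)) (∈-map⁺ (inside ∷_) (∈-allSubsets S))

argmax : ∀ {n} {Q : Subset n → Set} → (∀ S → Dec (Q S)) → (v : Subset n → ℕ) → ∀ N → (∀ S → v S ≤ N) →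
         ∃ Q → ∃ λ F → Q F × (∀ G → Q G → v G ≤ v F)
argmax {n} {Q} Q? v N v≤N (F , qF) = go N F qF (m≤n+m N (v F))
  where
  -- The fuel bounds how far `v F` still is from `N`; each improvement uses up at least one unit.
  go : ∀ fuel F → Q F → N ≤ v F + fuel → ∃ λ F → Q F × (∀ G → Q G → v G ≤ v F)
  go fuel F qF le with anySubset? (λ G → Q? G ×-dec (v F <? v G))
  ... | no none = F , qF , λ G qG → ≮⇒≥ λ lt → none (G , qG , lt)
  go zero F qF le | yes (G , qG , lt) =
    contradiction (≤-trans lt (v≤N G)) (≤⇒≯ (≤-trans le (≤-reflexive (+-identityʳ (v F)))))
  go (suc fuel) F qF le | yes (G , qG , lt) =
    go fuel G qG (≤-trans le (≤-trans (≤-reflexive (+-suc (v F) fuel)) (+-monoˡ-≤ fuel lt)))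

-- Skips the value 1, which becomes the private colour of a newly prepended element, and keeps the
-- common colour 0.
shift : ∀ {m} → Fin (suc m) → Fin (suc (suc m))
shift zero = zero
shift (suc j) = suc (suc j)

-- Colour 0 is left for the elements outside G.
enumerate : ∀ {n} (G : Subset n) → Fin n → Fin (suc ∣ G ∣)
enumerate (outside ∷ G) zero = zero
enumerate (outside ∷ G) (suc x) = enumerate G x
enumerate (inside ∷ G) zero = suc zero
enumerate (inside ∷ G) (suc x) = shift (enumerate G x)

∉⇒enumerate≡0 : ∀ {n} (G : Subset n) {x} → x ∉ G → enumerate G x ≡ zero
∉⇒enumerate≡0 (outside ∷ G) {zero} x∉ = refl
∉⇒enumerate≡0 (outside ∷ G) {suc x} x∉ = ∉⇒enumerate≡0 G (x∉ ∘ there)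
∉⇒enumerate≡0 (inside ∷ G) {zero} x∉ = contradiction here x∉
∉⇒enumerate≡0 (inside ∷ G) {suc x} x∉ = cong shift (∉⇒enumerate≡0 G (x∉ ∘ there))

enumerate-onto : ∀ {n} (G : Subset n) j → ∃ λ x → enumerate G x ≡ suc j
enumerate-onto (outside ∷ G) j = let (x , eq) = enumerate-onto G j in suc x , eq
enumerate-onto (inside ∷ G) zero = zero , refl
enumerate-onto (inside ∷ G) (suc j) = let (x , eq) = enumerate-onto G j in suc x , cong shift eq

-- Rank

module _ {n : ℕ} (M : Matroid n) where

  -- A named copy of the step local to `rank`; the two agree by computation, so facts about this
  -- fold are facts about `rank`.
  rankStep : Subset n → Subset n → ℕ → ℕ
  rankStep S T a = if does (T ⊆? S) then (if indep M T then ∣ T ∣ ⊔ a else a) else a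

  ∣I∣≤rank : ∀ {S I} → Independent M I → I ⊆ S → ∣ I ∣ ≤ rank M S
  ∣I∣≤rank {S} {I} ind I⊆S = go (allSubsets n) (∈-allSubsets I)
    where
    a≤step : ∀ T a → a ≤ rankStep S T a
    a≤step T a with T ⊆? S | indep M T
    ... | yes _ | true = m≤n⊔m ∣ T ∣ a
    ... | yes _ | false = ≤-refl
    ... | no _ | _ = ≤-refl
    go : ∀ xs → I ∈ˡ xs → ∣ I ∣ ≤ foldr (rankStep S) 0 xs
    go (T ∷ xs) (here refl) with I ⊆? S
    ... | no ¬p = contradiction (λ {x} → I⊆S {x}) ¬p
    ... | yes _ rewrite ind = m≤m⊔n _ _
    go (T ∷ xs) (there I∈) = ≤-trans (go xs I∈) (a≤step T _)

  rank-witness : ∀ S → ∃ λ I → I ⊆ S × Independent M I × ∣ I ∣ ≡ rank M S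
  rank-witness S = go (allSubsets n)
    where
    go : ∀ xs → ∃ λ I → I ⊆ S × Independent M I × ∣ I ∣ ≡ foldr (rankStep S) 0 xs
    go [] = ⊥ , (λ x∈ → contradiction x∈ ∉⊥) , indep-empty M , ∣⊥∣≡0 n
    go (T ∷ xs) with T ⊆? S | indep M T in ind
    ... | no _ | _ = go xs
    ... | yes _ | false = go xs
    ... | yes T⊆S | true with ⊔-sel ∣ T ∣ (foldr (rankStep S) 0 xs)
    ...   | inj₁ eq = T , T⊆S , ind , sym eq
    ...   | inj₂ eq = let (I , I⊆S , indI , eqI) = go xs in I , I⊆S , indI , trans eqI (sym eq)

  rank-mono : ∀ {S T} → S ⊆ T → rank M S ≤ rank M T
  rank-mono {S} S⊆T = let (I , I⊆S , ind , eq) = rank-witness S in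
    subst (_≤ _) eq (∣I∣≤rank ind (S⊆T ∘ I⊆S))

  rank≤∣S∣ : ∀ S → rank M S ≤ ∣ S ∣
  rank≤∣S∣ S = let (I , I⊆S , ind , eq) = rank-witness S in subst (_≤ _) eq (p⊆q⇒∣p∣≤∣q∣ I⊆S)

  ∣S∣≤rank⇒independent : ∀ {S} → ∣ S ∣ ≤ rank M S → Independent M S
  ∣S∣≤rank⇒independent {S} le = let (I , I⊆S , ind , eq) = rank-witness S in
    indep-down M ind (⊆∧∣∣≥⇒⊇ I⊆S (≤-trans le (≤-reflexive (sym eq))))

  -- Augment from a maximum independent subset of `S` until its size is reached.
  extend : ∀ {S I} → Independent M I → I ⊆ S →
           ∃ λ J → I ⊆ J × J ⊆ S × Independent M J × rank M S ≤ ∣ J ∣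
  extend {S} {I} = go I (⊃-wellFounded I)
    where
    go : ∀ I → Acc _ I → Independent M I → I ⊆ S →
         ∃ λ J → I ⊆ J × J ⊆ S × Independent M J × rank M S ≤ ∣ J ∣
    go I (acc rs) ind I⊆S with rank M S ≤? ∣ I ∣
    ... | yes le = I , id , I⊆S , ind , le
    ... | no ¬le = let
      (W , W⊆S , indW , eqW) = rank-witness S
      (x , x∈W , x∉I , ind⁺) = indep-aug M ind indW (subst (∣ I ∣ <_) (sym eqW) (≰⇒> ¬le))
      (J , I⁺⊆J , rest) = go (I ∪ ⁅ x ⁆) (rs (p⊂p∪⁅x⁆ x∉I)) ind⁺
        λ y∈ → [ I⊆S , (λ y∈x → subst (_∈ S) (sym (x∈⁅y⁆⇒x≡y x y∈x)) (W⊆S x∈W)) ]′ (x∈p∪q⁻ I ⁅ x ⁆ y∈)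
      in J , I⁺⊆J ∘ p⊆p∪q ⁅ x ⁆ , rest

  -- A maximum independent `I` in `V` extends to a maximum independent `J` in `S ∪ T`. The
  -- independent sets `J ∩ S` and `J ∩ T` cover `J` and both contain `I`. Taking `U` and `V` as
  -- arbitrary subsets of the union and the intersection builds monotonicity in.
  rank-submodular : ∀ {U V} S T → U ⊆ S ∪ T → V ⊆ S → V ⊆ T → rank M U + rank M V ≤ rank M S + rank M T
  rank-submodular {U} {V} S T U⊆ V⊆S V⊆T = let
    (I , I⊆V , indI , eqI) = rank-witness V
    (J , I⊆J , J⊆ , indJ , leJ) = extend indI (p⊆p∪q T ∘ V⊆S ∘ I⊆V)
    in begin
    rank M U + rank M V            ≤⟨ +-mono-≤ (≤-trans (rank-mono U⊆) leJ) (≤-reflexive (sym eqI)) ⟩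
    ∣ J ∣ + ∣ I ∣                  ≤⟨ ∣u∣+∣v∣≤∣p∣+∣q∣ {p = J ∩ S} {J ∩ T}
                                      (λ x∈J x∈I → x∈p∩q⁺ (x∈J , V⊆S (I⊆V x∈I)) , x∈p∩q⁺ (x∈J , V⊆T (I⊆V x∈I)))
                                      (λ x∈J → x∈p∪q⁺ ([ (λ x∈S → inj₁ (x∈p∩q⁺ (x∈J , x∈S))) , (λ x∈T → inj₂ (x∈p∩q⁺ (x∈J , x∈T))) ]′
                                                       (x∈p∪q⁻ S T (J⊆ x∈J))))
                                      (λ x∈I → x∈p∪q⁺ (inj₁ (x∈p∩q⁺ (I⊆J x∈I , V⊆S (I⊆V x∈I))))) ⟩
    ∣ J ∩ S ∣ + ∣ J ∩ T ∣          ≤⟨ +-mono-≤ (∣I∣≤rank (indep-down M indJ (p∩q⊆p J S)) (p∩q⊆q J S))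
                                              (∣I∣≤rank (indep-down M indJ (p∩q⊆p J T)) (p∩q⊆q J T)) ⟩
    rank M S + rank M T            ∎
    where open ≤-Reasoning

  rank-∪ : ∀ S T → rank M (S ∪ T) ≤ rank M S + rank M T
  rank-∪ S T = ≤-trans (m≤m+n _ (rank M ⊥)) (rank-submodular S T id ⊥⊆ ⊥⊆)

  rank-⊥ : rank M ⊥ ≡ 0
  rank-⊥ = n≤0⇒n≡0 (subst (rank M ⊥ ≤_) (∣⊥∣≡0 n) (rank≤∣S∣ ⊥))

  rank-empty : ∀ {S} → (∀ {x} → x ∉ S) → rank M S ≤ 0
  rank-empty no-x = ≤-trans (rank-mono λ x∈ → contradiction x∈ no-x) (≤-reflexive rank-⊥)

  basis⇒rank≤∣B∣ : ∀ {B} → IsBasis M B → rank M ⊤ ≤ ∣ B ∣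
  basis⇒rank≤∣B∣ {B} (ind , maximal) with rank M ⊤ ≤? ∣ B ∣
  ... | yes le = le
  ... | no ¬le = let
    (W , _ , indW , eqW) = rank-witness ⊤
    (x , _ , x∉B , ind⁺) = indep-aug M ind indW (subst (∣ B ∣ <_) (sym eqW) (≰⇒> ¬le))
    in contradiction ind⁺ (maximal x x∉B)

  rank≤∣B∣⇒basis : ∀ {B} → Independent M B → rank M ⊤ ≤ ∣ B ∣ → IsBasis M B
  rank≤∣B∣⇒basis ind le = ind , λ x x∉B ind⁺ →
    <⇒≱ (x∉p⇒1+∣p∣≤∣p∪⁅x⁆∣ x∉B) (≤-trans (∣I∣≤rank ind⁺ ⊆⊤) le)

  -- Add rank-preserving elements until none is left. This carries inequalities known for flats over
  -- to arbitrary sets.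
  ∃-closure : ∀ S → ∃ λ F → S ⊆ F × rank M F ≡ rank M S × IsFlat M F
  ∃-closure S = go S (⊃-wellFounded S)
    where
    go : ∀ S → Acc _ S → ∃ λ F → S ⊆ F × rank M F ≡ rank M S × IsFlat M F
    go S (acc rs) with any? (λ x → ¬? (x ∈? S) ×-dec (rank M (S ∪ ⁅ x ⁆) ≟ℕ rank M S))
    ... | yes (x , x∉S , eq) = let
      (F , ⊆F , eqF , flat) = go (S ∪ ⁅ x ⁆) (rs (p⊂p∪⁅x⁆ x∉S))
      in F , ⊆F ∘ p⊆p∪q ⁅ x ⁆ , trans eqF eq , flat
    ... | no none = S , id , refl , λ x eq → decidable-stable (x ∈? S) λ x∉S → none (x , x∉S , eq)

  -- Rado's theorem and symmetric exchange

  -- The confining sets `E i` may differ: exchange uses them to steer one element into a chosen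
  -- part, while packing takes all of them equal to `A`.
  record IndependentCover {t} (A : Subset n) (E : Fin t → Subset n) : Set where
    field
      part : Fin t → Subset n
      part-independent : ∀ i → Independent M (part i)
      part-⊆ : ∀ i → part i ⊆ E i
      part-disjoint : Disjoint part
      part-covers : ∀ {x} → x ∈ A → ∃ λ i → x ∈ part i

    ∣A∣≥t*rank⇒basis : t * rank M ⊤ ≤ ∣ A ∣ → ∀ i → IsBasis M (part i)
    ∣A∣≥t*rank⇒basis le i = rank≤∣B∣⇒basis (part-independent i)
      (t*m≤sum⇒m≤f (λ i → ∣ part i ∣) (λ i → ∣I∣≤rank (part-independent i) ⊆⊤)
        (≤-trans le (cover⇒∣A∣≤sum part A part-covers)) i)

  module _ {t : ℕ} (A : Subset n) where

    -- The matroid union condition for the restrictions of `M` to the sets `E i`.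
    Hall : (Fin t → Subset n) → Set
    Hall E = ∀ S → ∣ S ∩ A ∣ ≤ sum (λ i → rank M (S ∩ E i))

    drop : (Fin t → Subset n) → Fin t → Fin n → Fin t → Subset n
    drop E i x l = if does (l ≟ i) then E l - x else E l

    drop-⊆ : ∀ E i x l → drop E i x l ⊆ E l
    drop-⊆ E i x l y∈ with l ≟ i
    ... | yes _ = p─q⊆p (E l) ⁅ x ⁆ y∈
    ... | no _ = y∈

    ∈-drop : ∀ E i x {l y} → y ∈ E l → y ≢ x ⊎ l ≢ i → y ∈ drop E i x l
    ∈-drop E i x {l} y∈ ne with l ≟ i | ne
    ... | no _ | _ = y∈
    ... | yes _ | inj₁ y≢x = x∈p∧x≢y⇒x∈p-y y∈ y≢x
    ... | yes l≡i | inj₂ l≢i = contradiction l≡i l≢i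

    sum-drop-< : ∀ E i x → x ∈ E i → sum (∣_∣ ∘ drop E i x) < sum (∣_∣ ∘ E)
    sum-drop-< E i x x∈ = sum-mono-< (λ l → p⊆q⇒∣p∣≤∣q∣ (drop-⊆ E i x l)) i
      (p⊂q⇒∣p∣<∣q∣ (drop-⊆ E i x i , x , x∈ , x∉))
      where
      x∉ : x ∉ drop E i x i
      x∉ x∈′ with i ≟ i
      ... | yes _ = x∈p-y⇒x≢y (E i) x∈′ refl
      ... | no i≢i = i≢i refl

    -- Uncrossing: a violated set for each of the two deletions contains x, and submodularity
    -- would make the union or the x-deleted intersection violate Hall E.
    drop-one : ∀ E i j x → i ≢ j → Hall E → Hall (drop E i x) ⊎ Hall (drop E j x)
    drop-one E i j x i≢j hall with ∀-or-∃¬ (λ S → ∣ S ∩ A ∣ ≤? sum (λ l → rank M (S ∩ drop E i x l)))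
                                 | ∀-or-∃¬ (λ S → ∣ S ∩ A ∣ ≤? sum (λ l → rank M (S ∩ drop E j x l)))
    ... | inj₁ ok | _ = inj₁ ok
    ... | inj₂ _ | inj₁ ok = inj₂ ok
    ... | inj₂ (S , badS) | inj₂ (T , badT) = contradiction bound (<⇒≱ (s≤s (≤-reflexive (sym (+-suc (sum a) (sum b))))))
      where
      open ≤-Reasoning
      x∈violator : ∀ k S → ¬ (∣ S ∩ A ∣ ≤ sum (λ l → rank M (S ∩ drop E k x l))) → x ∈ S
      x∈violator k S bad = decidable-stable (x ∈? S) λ x∉S → bad (≤-trans (hall S) (sum-mono λ l →
        rank-mono λ y∈ → let (y∈S , y∈E) = x∈p∩q⁻ S (E l) y∈ in
          x∈p∩q⁺ (y∈S , ∈-drop E k x y∈E (inj₁ λ { refl → x∉S y∈S }))))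
      x∈S = x∈violator i S badS
      x∈T = x∈violator j T badT
      a b : Fin t → ℕ
      a l = rank M (S ∩ drop E i x l)
      b l = rank M (T ∩ drop E j x l)
      R = (S ∩ T) - x
      pointwise : ∀ l → rank M ((S ∪ T) ∩ E l) + rank M (R ∩ E l) ≤ a l + b l
      pointwise l = rank-submodular (S ∩ drop E i x l) (T ∩ drop E j x l) join
        (λ y∈ → let (y∈R , y∈E) = x∈p∩q⁻ R (E l) y∈ in
          x∈p∩q⁺ (proj₁ (x∈p∩q⁻ S T (p─q⊆p (S ∩ T) ⁅ x ⁆ y∈R)) , ∈-drop E i x y∈E (inj₁ (x∈p-y⇒x≢y (S ∩ T) y∈R))))
        (λ y∈ → let (y∈R , y∈E) = x∈p∩q⁻ R (E l) y∈ in
          x∈p∩q⁺ (proj₂ (x∈p∩q⁻ S T (p─q⊆p (S ∩ T) ⁅ x ⁆ y∈R)) , ∈-drop E j x y∈E (inj₁ (x∈p-y⇒x≢y (S ∩ T) y∈R))))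
        where
        -- The deletions hit different indices, so `x` survives in the join: at index `i` the second
        -- family supplies it, elsewhere the first.
        split : ∀ {y} → y ∈ S ∪ T → y ∈ E l → Dec (y ≡ x) → Dec (l ≡ i) →
                y ∈ (S ∩ drop E i x l) ∪ (T ∩ drop E j x l)
        split _ y∈E (yes refl) (yes refl) = x∈p∪q⁺ (inj₂ (x∈p∩q⁺ (x∈T , ∈-drop E j x y∈E (inj₂ i≢j))))
        split _ y∈E (yes refl) (no l≢i) = x∈p∪q⁺ (inj₁ (x∈p∩q⁺ (x∈S , ∈-drop E i x y∈E (inj₂ l≢i))))
        split y∈S∪T y∈E (no y≢x) _ = x∈p∪q⁺
          ([ (λ y∈S → inj₁ (x∈p∩q⁺ (y∈S , ∈-drop E i x y∈E (inj₁ y≢x))))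
           , (λ y∈T → inj₂ (x∈p∩q⁺ (y∈T , ∈-drop E j x y∈E (inj₁ y≢x)))) ]′ (x∈p∪q⁻ S T y∈S∪T))
        join : (S ∪ T) ∩ E l ⊆ (S ∩ drop E i x l) ∪ (T ∩ drop E j x l)
        join {y} y∈ = let (y∈S∪T , y∈E) = x∈p∩q⁻ (S ∪ T) (E l) y∈ in split y∈S∪T y∈E (y ≟ x) (l ≟ i)
      R⊇ : (S ∩ T) ∩ A ⊆ (R ∩ A) ∪ ⁅ x ⁆
      R⊇ {y} y∈ with x∈p∩q⁻ (S ∩ T) A y∈ | y ≟ x
      ... | _ | yes refl = q⊆p∪q (R ∩ A) ⁅ x ⁆ (x∈⁅x⁆ x)
      ... | y∈ST , y∈A | no y≢x = p⊆p∪q ⁅ x ⁆ (x∈p∩q⁺ (x∈p∧x≢y⇒x∈p-y y∈ST y≢x , y∈A))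
      modular : ∣ S ∩ A ∣ + ∣ T ∩ A ∣ ≤ ∣ (S ∪ T) ∩ A ∣ + ∣ (S ∩ T) ∩ A ∣
      modular = ∣u∣+∣v∣≤∣p∣+∣q∣
        (λ yS yT → let (y∈S , y∈A) = x∈p∩q⁻ S A yS ; (y∈T , _) = x∈p∩q⁻ T A yT in
          x∈p∩q⁺ (p⊆p∪q T y∈S , y∈A) , x∈p∩q⁺ (x∈p∩q⁺ (y∈S , y∈T) , y∈A))
        (λ yS → let (y∈S , y∈A) = x∈p∩q⁻ S A yS in p⊆p∪q _ (x∈p∩q⁺ (p⊆p∪q T y∈S , y∈A)))
        (λ yT → let (y∈T , y∈A) = x∈p∩q⁻ T A yT in p⊆p∪q _ (x∈p∩q⁺ (q⊆p∪q S T y∈T , y∈A)))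
      -- The two violations are strict and gain 2, while putting `x` back into `R` costs only 1.
      bound : suc (sum a + suc (sum b)) ≤ suc (sum a + sum b)
      bound = begin
        suc (sum a) + suc (sum b)                  ≤⟨ +-mono-≤ (≰⇒> badS) (≰⇒> badT) ⟩
        ∣ S ∩ A ∣ + ∣ T ∩ A ∣                       ≤⟨ modular ⟩
        ∣ (S ∪ T) ∩ A ∣ + ∣ (S ∩ T) ∩ A ∣           ≤⟨ +-monoʳ-≤ ∣ (S ∪ T) ∩ A ∣ (∣u∣≤∣p∣+∣q∣ R⊇) ⟩
        ∣ (S ∪ T) ∩ A ∣ + (∣ R ∩ A ∣ + ∣ ⁅ x ⁆ ∣)    ≡⟨ +-assoc ∣ (S ∪ T) ∩ A ∣ _ _ ⟨
        ∣ (S ∪ T) ∩ A ∣ + ∣ R ∩ A ∣ + ∣ ⁅ x ⁆ ∣      ≤⟨ +-mono-≤ (+-mono-≤ (hall (S ∪ T)) (hall R)) (≤-reflexive (∣⁅x⁆∣≡1 x)) ⟩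
        sum (λ l → rank M ((S ∪ T) ∩ E l)) + sum (λ l → rank M (R ∩ E l)) + 1
                                                   ≡⟨ cong (_+ 1) (∑-distrib-+ (λ l → rank M ((S ∪ T) ∩ E l)) _) ⟨
        sum (λ l → rank M ((S ∪ T) ∩ E l) + rank M (R ∩ E l)) + 1
                                                   ≤⟨ +-monoˡ-≤ 1 (sum-mono pointwise) ⟩
        sum (λ l → a l + b l) + 1                  ≡⟨ cong (_+ 1) (∑-distrib-+ a b) ⟩
        sum a + sum b + 1                          ≡⟨ +-comm _ 1 ⟩
        suc (sum a + sum b)                        ∎

    -- Delete memberships while the condition survives; by `drop-one` this stops only when the `E i`
    -- are disjoint. Then the condition for `A ∩ E i` has a single nonzero term on the right and
    -- says that this set is independent, and the condition for singletons says that `A` is covered.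
    hall⇒cover : ∀ E → Hall E → IndependentCover A E
    hall⇒cover E = go E (<-wellFounded _)
      where
      weaken : ∀ {E E′} → (∀ i → E′ i ⊆ E i) → IndependentCover A E′ → IndependentCover A E
      weaken E′⊆E cover = record
        { part = part ; part-independent = part-independent ; part-⊆ = λ i → E′⊆E i ∘ part-⊆ i
        ; part-disjoint = part-disjoint ; part-covers = part-covers }
        where open IndependentCover cover
      go : ∀ E → Acc _<_ (sum (∣_∣ ∘ E)) → Hall E → IndependentCover A E
      go E (acc rs) hall with any? (λ x → any? λ i → any? λ j → ¬? (i ≟ j) ×-dec x ∈? E i ×-dec x ∈? E j)
      ... | yes (x , i , j , i≢j , x∈Ei , x∈Ej) with drop-one E i j x i≢j hall
      ...   | inj₁ ok = weaken (drop-⊆ E i x) (go _ (rs (sum-drop-< E i x x∈Ei)) ok)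
      ...   | inj₂ ok = weaken (drop-⊆ E j x) (go _ (rs (sum-drop-< E j x x∈Ej)) ok)
      go E (acc rs) hall | no none = record
        { part = I
        ; part-independent = λ i → ∣S∣≤rank⇒independent (begin
            ∣ I i ∣                            ≤⟨ p⊆q⇒∣p∣≤∣q∣ (λ x∈ → x∈p∩q⁺ (x∈ , p∩q⊆p A (E i) x∈)) ⟩
            ∣ I i ∩ A ∣                        ≤⟨ hall (I i) ⟩
            sum (λ l → rank M (I i ∩ E l))     ≤⟨ sum-single (λ l → rank M (I i ∩ E l)) i (λ l l≢i → rank-empty λ {x} x∈ →
                                                    let (x∈I , x∈El) = x∈p∩q⁻ (I i) (E l) x∈ in
                                                    disj l i l≢i x x∈El (p∩q⊆q A (E i) x∈I)) ⟩
            rank M (I i ∩ E i)                 ≤⟨ rank-mono (p∩q⊆p (I i) (E i)) ⟩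
            rank M (I i)                       ∎)
        ; part-⊆ = λ i → p∩q⊆q A (E i)
        ; part-disjoint = λ i j i≢j x x∈i x∈j → disj i j i≢j x (p∩q⊆q A (E i) x∈i) (p∩q⊆q A (E j) x∈j)
        ; part-covers = covers }
        where
        open ≤-Reasoning
        I : Fin t → Subset n
        I i = A ∩ E i
        disj : Disjoint E
        disj i j i≢j x x∈i x∈j = none (x , i , j , i≢j , x∈i , x∈j)
        covers : ∀ {x} → x ∈ A → ∃ λ i → x ∈ I i
        covers {x} x∈A with any? (λ i → x ∈? E i)
        ... | yes (i , x∈E) = i , x∈p∩q⁺ (x∈A , x∈E)
        ... | no x∉E = contradiction (begin
          1                                   ≡⟨ ∣⁅x⁆∣≡1 x ⟨
          ∣ ⁅ x ⁆ ∣                           ≤⟨ p⊆q⇒∣p∣≤∣q∣ (λ y∈ → x∈p∩q⁺ (y∈ , subst (_∈ A) (sym (x∈⁅y⁆⇒x≡y x y∈)) x∈A)) ⟩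
          ∣ ⁅ x ⁆ ∩ A ∣                       ≤⟨ hall ⁅ x ⁆ ⟩
          sum (λ l → rank M (⁅ x ⁆ ∩ E l))    ≤⟨ sum-zero (λ l → rank-empty λ y∈ → let (y∈x , y∈E) = x∈p∩q⁻ ⁅ x ⁆ (E l) y∈ in
                                                  x∉E (l , subst (_∈ E l) (x∈⁅y⁆⇒x≡y x y∈x) y∈E)) ⟩
          0                                   ∎) λ ()

  -- Cover `B ∪ C` by two independent sets confined to `B ∪ ⁅ x ⁆` and `B ∪ (C - x)`. Since `B ∪ C`
  -- has at least `2 r` elements, both are bases, and `x` can only lie in the first.
  exchange : ∀ {B C x} → IsBasis M B → IsBasis M C → (∀ {y} → y ∈ B → y ∉ C) → x ∈ C →
             ∃ λ B′ → ∃ λ C′ → IsBasis M B′ × IsBasis M C′ × x ∈ B′ × B′ ⊆ B ∪ ⁅ x ⁆ ×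
             C′ ⊆ B ∪ (C - x) × (∀ {y} → y ∈ B′ → y ∉ C′)
  exchange {B} {C} {x} isB isC disj x∈C = part zero , part (suc zero) , basis zero , basis (suc zero) ,
    x∈part , part-⊆ zero , part-⊆ (suc zero) , λ {y} → part-disjoint zero (suc zero) (λ ()) y
    where
    open ≤-Reasoning
    E : Fin 2 → Subset n
    E zero = B ∪ ⁅ x ⁆
    E (suc _) = B ∪ (C - x)
    hall : Hall (B ∪ C) E
    hall S with x ∈? S
    ... | no x∉S = begin
      ∣ S ∩ (B ∪ C) ∣                           ≤⟨ ∣u∣≤∣p∣+∣q∣ (⊆-reflexive (∩-distribˡ-∪ S B C)) ⟩
      ∣ S ∩ B ∣ + ∣ S ∩ C ∣                     ≤⟨ +-mono-≤ (∣I∣≤rank (indep-down M (proj₁ isB) (p∩q⊆q S B)) λ y∈ →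
                                                     let (y∈S , y∈B) = x∈p∩q⁻ S B y∈ in x∈p∩q⁺ (y∈S , p⊆p∪q ⁅ x ⁆ y∈B))
                                                   (∣I∣≤rank (indep-down M (proj₁ isC) (p∩q⊆q S C)) λ y∈ →
                                                     let (y∈S , y∈C) = x∈p∩q⁻ S C y∈ in
                                                     x∈p∩q⁺ (y∈S , q⊆p∪q B (C - x) (x∈p∧x≢y⇒x∈p-y y∈C λ { refl → x∉S y∈S }))) ⟩
      rank M (S ∩ E zero) + rank M (S ∩ E (suc zero))        ≡⟨ cong (rank M (S ∩ E zero) +_) (+-identityʳ _) ⟨
      rank M (S ∩ E zero) + (rank M (S ∩ E (suc zero)) + 0)  ∎
    ... | yes x∈S = begin
      ∣ S ∩ (B ∪ C) ∣                           ≤⟨ main ⟩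
      rank M (S ∩ E zero) + rank M (S ∩ E (suc zero))        ≡⟨ cong (rank M (S ∩ E zero) +_) (+-identityʳ _) ⟨
      rank M (S ∩ E zero) + (rank M (S ∩ E (suc zero)) + 0)  ∎
      where
      E₀ = S ∩ E zero
      E₁ = S ∩ E (suc zero)
      B⊆E₀ : (S ∩ B) ∪ ⁅ x ⁆ ⊆ E₀
      B⊆E₀ y∈ = [ (λ y∈SB → let (y∈S , y∈B) = x∈p∩q⁻ S B y∈SB in x∈p∩q⁺ (y∈S , p⊆p∪q ⁅ x ⁆ y∈B))
                , (λ y∈x → x∈p∩q⁺ (subst (_∈ S) (sym (x∈⁅y⁆⇒x≡y x y∈x)) x∈S , q⊆p∪q B ⁅ x ⁆ y∈x)) ]′ (x∈p∪q⁻ (S ∩ B) ⁅ x ⁆ y∈)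
      ∣S∩B∣≤ : ∣ S ∩ B ∣ ≤ rank M (S ∩ B)
      ∣S∩B∣≤ = ∣I∣≤rank (indep-down M (proj₁ isB) (p∩q⊆q S B)) id
      C-x⊆E₁ : (S ∩ C) - x ⊆ E₁
      C-x⊆E₁ y∈ = let (y∈S , y∈C) = x∈p∩q⁻ S C (p─q⊆p (S ∩ C) ⁅ x ⁆ y∈) in
        x∈p∩q⁺ (y∈S , q⊆p∪q B (C - x) (x∈p∧x≢y⇒x∈p-y y∈C (x∈p-y⇒x≢y (S ∩ C) y∈)))
      indC : Independent M (S ∩ C)
      indC = indep-down M (proj₁ isC) (p∩q⊆q S C)
      main : ∣ S ∩ (B ∪ C) ∣ ≤ rank M E₀ + rank M E₁
      main with rank M ((S ∩ B) ∪ ⁅ x ⁆) ≤? ∣ S ∩ B ∣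
      -- Here `x` is independent of `S ∩ B`, so it is counted in `E₀` and given up in `S ∩ C`.
      ... | no ¬le = begin
        ∣ S ∩ (B ∪ C) ∣                 ≤⟨ ∣u∣≤∣p∣+∣q∣ (⊆-reflexive (∩-distribˡ-∪ S B C)) ⟩
        ∣ S ∩ B ∣ + ∣ S ∩ C ∣           ≤⟨ +-monoʳ-≤ ∣ S ∩ B ∣ (∣p∣≤1+∣p-x∣ (S ∩ C) x) ⟩
        ∣ S ∩ B ∣ + suc ∣ (S ∩ C) - x ∣ ≡⟨ +-suc ∣ S ∩ B ∣ _ ⟩
        suc ∣ S ∩ B ∣ + ∣ (S ∩ C) - x ∣ ≤⟨ +-mono-≤ (≤-trans (≰⇒> ¬le) (rank-mono B⊆E₀))
                                            (∣I∣≤rank (indep-down M indC (p─q⊆p (S ∩ C) ⁅ x ⁆)) C-x⊆E₁) ⟩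
        rank M E₀ + rank M E₁           ∎
      -- Here `S ∩ B` spans `x`. As `S ∩ B` also lies in `E₁`, submodularity shows that `E₁` loses
      -- no rank by missing `x`.
      ... | yes le = begin
        ∣ S ∩ (B ∪ C) ∣                 ≤⟨ ∣u∣≤∣p∣+∣q∣ (⊆-reflexive (∩-distribˡ-∪ S B C)) ⟩
        ∣ S ∩ B ∣ + ∣ S ∩ C ∣           ≤⟨ +-mono-≤ (≤-trans ∣S∩B∣≤ (rank-mono (B⊆E₀ ∘ p⊆p∪q ⁅ x ⁆))) (+-cancelʳ-≤ ∣ S ∩ B ∣ _ _ (begin
          ∣ S ∩ C ∣ + ∣ S ∩ B ∣         ≤⟨ +-mono-≤ (∣I∣≤rank indC λ y∈ → y∈) ∣S∩B∣≤ ⟩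
          rank M (S ∩ C) + rank M (S ∩ B)
            ≤⟨ rank-submodular E₁ ((S ∩ B) ∪ ⁅ x ⁆)
                 (λ y∈ → [ (λ y∈C → p⊆p∪q _ (C-x⊆E₁ y∈C)) , (λ y∈x → q⊆p∪q E₁ _ (q⊆p∪q (S ∩ B) ⁅ x ⁆ y∈x)) ]′
                           (x∈p∪q⁻ _ ⁅ x ⁆ (p⊆p-x∪⁅x⁆ (S ∩ C) x y∈)))
                 (λ y∈ → let (y∈S , y∈B) = x∈p∩q⁻ S B y∈ in x∈p∩q⁺ (y∈S , p⊆p∪q (C - x) y∈B))
                 (p⊆p∪q ⁅ x ⁆) ⟩
          rank M E₁ + rank M ((S ∩ B) ∪ ⁅ x ⁆)  ≤⟨ +-monoʳ-≤ _ le ⟩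
          rank M E₁ + ∣ S ∩ B ∣         ∎)) ⟩
        rank M E₀ + rank M E₁           ∎
    open IndependentCover (hall⇒cover (B ∪ C) E hall)
    basis : ∀ i → IsBasis M (part i)
    basis = ∣A∣≥t*rank⇒basis (begin
      rank M ⊤ + (rank M ⊤ + 0)  ≡⟨ cong (rank M ⊤ +_) (+-identityʳ _) ⟩
      rank M ⊤ + rank M ⊤        ≤⟨ +-mono-≤ (basis⇒rank≤∣B∣ isB) (basis⇒rank≤∣B∣ isC) ⟩
      ∣ B ∣ + ∣ C ∣              ≤⟨ ∣u∣+∣v∣≤∣p∣ disj (p⊆p∪q C) (q⊆p∪q B C) ⟩
      ∣ B ∪ C ∣                  ∎)
    x∈part : x ∈ part zero
    x∈part with part-covers (q⊆p∪q B C x∈C)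
    ... | zero , x∈ = x∈
    ... | suc zero , x∈ = contradiction (part-⊆ (suc zero) x∈) λ x∈E →
      [ (λ x∈B → disj x∈B x∈C) , (λ x∈C-x → x∈p-y⇒x≢y C x∈C-x refl) ]′ (x∈p∪q⁻ B (C - x) x∈E)

  -- Packing bases

  module _ (t : ℕ) where

    Packable : Subset n → Set
    Packable A = ∀ S → t * rank M ⊤ ≤ t * rank M S + ∣ A ─ S ∣

    -- Only the inequality opposite to `Packable`; for a packable `A` it means equality.
    Tight : Subset n → Subset n → Set
    Tight A F = t * rank M F + ∣ A ─ F ∣ ≤ t * rank M ⊤

    packable-or-∃¬ : ∀ A → Packable A ⊎ ∃ λ S → ¬ (t * rank M ⊤ ≤ t * rank M S + ∣ A ─ S ∣)
    packable-or-∃¬ A = ∀-or-∃¬ λ S → t * rank M ⊤ ≤? t * rank M S + ∣ A ─ S ∣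

    packable? : ∀ A → Dec (Packable A)
    packable? A with packable-or-∃¬ A
    ... | inj₁ pk = yes pk
    ... | inj₂ (S , bad) = no λ pk → bad (pk S)

    tight-⊤ : ∀ A → Tight A ⊤
    tight-⊤ A = ≤-reflexive (trans (cong (λ S → t * rank M ⊤ + ∣ S ∣) (p─⊤≡⊥ A))
      (trans (cong (t * rank M ⊤ +_) (∣⊥∣≡0 n)) (+-identityʳ _)))

    -- The function `t r(S) + |A ─ S|` is submodular in `S`. For packable `A` its minimum is `t r`,
    -- so tight sets are its minimisers, and these are closed under intersection.
    tight-∩ : ∀ {A F S} → Packable A → Tight A F → Tight A S → Tight A (F ∩ S)
    tight-∩ {A} {F} {S} pk tightF tightS = +-cancelˡ-≤ (t * rank M ⊤) _ _ (begin
      t * rank M ⊤ + (t * rank M (F ∩ S) + ∣ A ─ F ∩ S ∣)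
        ≤⟨ +-monoˡ-≤ _ (pk (F ∪ S)) ⟩
      (t * rank M (F ∪ S) + ∣ A ─ F ∪ S ∣) + (t * rank M (F ∩ S) + ∣ A ─ F ∩ S ∣)
        ≡⟨ interchange (t * rank M (F ∪ S)) ∣ A ─ F ∪ S ∣ _ _ ⟩
      (t * rank M (F ∪ S) + t * rank M (F ∩ S)) + (∣ A ─ F ∪ S ∣ + ∣ A ─ F ∩ S ∣)
        ≡⟨ cong (_+ (∣ A ─ F ∪ S ∣ + ∣ A ─ F ∩ S ∣)) (*-distribˡ-+ t (rank M (F ∪ S)) _) ⟨
      t * (rank M (F ∪ S) + rank M (F ∩ S)) + (∣ A ─ F ∪ S ∣ + ∣ A ─ F ∩ S ∣)
        ≤⟨ +-mono-≤ (*-monoʳ-≤ t (rank-submodular F S id (p∩q⊆p F S) (p∩q⊆q F S))) modular ⟩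
      t * (rank M F + rank M S) + (∣ A ─ F ∣ + ∣ A ─ S ∣)
        ≡⟨ cong (_+ (∣ A ─ F ∣ + ∣ A ─ S ∣)) (*-distribˡ-+ t (rank M F) _) ⟩
      (t * rank M F + t * rank M S) + (∣ A ─ F ∣ + ∣ A ─ S ∣)
        ≡⟨ interchange (t * rank M F) (t * rank M S) _ _ ⟩
      (t * rank M F + ∣ A ─ F ∣) + (t * rank M S + ∣ A ─ S ∣)
        ≤⟨ +-mono-≤ tightF tightS ⟩
      t * rank M ⊤ + t * rank M ⊤ ∎)
      where
      open ≤-Reasoning
      modular : ∣ A ─ F ∪ S ∣ + ∣ A ─ F ∩ S ∣ ≤ ∣ A ─ F ∣ + ∣ A ─ S ∣
      modular = ∣u∣+∣v∣≤∣p∣+∣q∣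
        (λ {x} x∈∪ _ → let x∈A = p─q⊆p A (F ∪ S) x∈∪ ; x∉ = x∈p─q⇒x∉q A (F ∪ S) x∈∪ in
          x∈p∧x∉q⇒x∈p─q x∈A (x∉ ∘ p⊆p∪q S) , x∈p∧x∉q⇒x∈p─q x∈A (x∉ ∘ q⊆p∪q F S))
        (λ x∈∪ → p⊆p∪q _ (x∈p∧x∉q⇒x∈p─q (p─q⊆p A (F ∪ S) x∈∪) (x∈p─q⇒x∉q A (F ∪ S) x∈∪ ∘ p⊆p∪q S)))
        outside-∩
        where
        outside-∩ : A ─ F ∩ S ⊆ (A ─ F) ∪ (A ─ S)
        outside-∩ {x} x∈ with x ∈? F
        ... | no x∉F = p⊆p∪q _ (x∈p∧x∉q⇒x∈p─q (p─q⊆p A (F ∩ S) x∈) x∉F)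
        ... | yes x∈F = q⊆p∪q _ _ (x∈p∧x∉q⇒x∈p─q (p─q⊆p A (F ∩ S) x∈)
                          λ x∈S → x∈p─q⇒x∉q A (F ∩ S) x∈ (x∈p∩q⁺ (x∈F , x∈S)))

    -- Take a set violating the condition for `A - e`. Deleting `e` lowers the bound by at most one,
    -- so this set was tight for `A`; and the bound drops at all only if `e` is outside the set.
    ∃-tight-avoiding-one : ∀ {A} e → Packable A → ¬ Packable (A - e) → ∃ λ S → Tight A S × e ∉ S
    ∃-tight-avoiding-one {A} e pk ¬pk with packable-or-∃¬ (A - e)
    ... | inj₁ pk⁻ = contradiction pk⁻ ¬pk
    ... | inj₂ (S , bad) = S , tight , e∉S
      where
      open ≤-Reasoning
      e∉S : e ∉ S
      e∉S e∈S = bad (≤-trans (pk S) (+-monoʳ-≤ (t * rank M S) (p⊆q⇒∣p∣≤∣q∣ {p = A ─ S} {(A - e) ─ S} λ x∈ →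
        x∈p∧x∉q⇒x∈p─q (x∈p∧x≢y⇒x∈p-y (p─q⊆p A S x∈) λ { refl → x∈p─q⇒x∉q A S x∈ e∈S }) (x∈p─q⇒x∉q A S x∈))))
      tight : Tight A S
      tight = begin
        t * rank M S + ∣ A ─ S ∣            ≤⟨ +-monoʳ-≤ _ (∣p∣≤1+∣p-x∣ (A ─ S) e) ⟩
        t * rank M S + suc ∣ (A ─ S) - e ∣  ≡⟨ cong (λ X → t * rank M S + suc ∣ X ∣) (p─q─r≡p─r─q A S ⁅ e ⁆) ⟩
        t * rank M S + suc ∣ (A - e) ─ S ∣  ≡⟨ +-suc _ _ ⟩
        suc (t * rank M S + ∣ (A - e) ─ S ∣) ≤⟨ ≰⇒> bad ⟩
        t * rank M ⊤                        ∎

    -- Start from `⊤` and intersect with a tight set missing some `e` in `F ∩ X` until that is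
    -- empty. Used with `X = A` to pack bases and with the repeated-colour elements to pack rainbow
    -- ones.
    ∃-tight-avoiding : ∀ {A} X → Packable A → (∀ {e} → e ∈ X → ¬ Packable (A - e)) →
                       ∃ λ F → Tight A F × (∀ {e} → e ∈ F → e ∉ X)
    ∃-tight-avoiding {A} X pk ¬pk = go ⊤ (⊂-wellFounded ⊤) (tight-⊤ A)
      where
      go : ∀ F → Acc _⊂_ F → Tight A F → ∃ λ F → Tight A F × (∀ {e} → e ∈ F → e ∉ X)
      go F (acc rs) tight with nonempty? (F ∩ X)
      ... | no empty = F , tight , λ e∈F e∈X → empty (_ , x∈p∩q⁺ (e∈F , e∈X))
      ... | yes (e , e∈) = let
        (e∈F , e∈X) = x∈p∩q⁻ F X e∈
        (S , tightS , e∉S) = ∃-tight-avoiding-one {A} e pk (¬pk e∈X)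
        in go (F ∩ S) (rs (p∩q⊆p F S , e , e∈F , e∉S ∘ p∩q⊆q F S)) (tight-∩ {A} {F} {S} pk tight tightS)

    -- In a minimal packable `A` every element is critical, so some tight `F` is disjoint from `A`.
    -- Comparing packability at `F ∪ (S ∩ A)` with tightness of `F` gives the union condition, and
    -- packability at `⊥` gives enough elements for every part to be a basis.
    pack : ∀ A → Packable A → ∃ λ (B : Fin t → Subset n) → (∀ i → IsBasis M (B i)) × (∀ i → B i ⊆ A) × Disjoint B
    pack A = go A (⊂-wellFounded A)
      where
      go : ∀ A → Acc _⊂_ A → Packable A →
           ∃ λ (B : Fin t → Subset n) → (∀ i → IsBasis M (B i)) × (∀ i → B i ⊆ A) × Disjoint B
      go A (acc rs) pk with any? (λ e → e ∈? A ×-dec packable? (A - e))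
      ... | yes (e , e∈A , pk⁻) = let (B , basis , B⊆ , disj) = go (A - e) (rs (x∈p⇒p-x⊂p e∈A)) pk⁻ in
        B , basis , (λ i → p─q⊆p A ⁅ e ⁆ ∘ B⊆ i) , disj
      ... | no stuck = part , ∣A∣≥t*rank⇒basis t*r≤∣A∣ , part-⊆ , part-disjoint
        where
        open ≤-Reasoning
        r = rank M ⊤
        ∃F = ∃-tight-avoiding {A} A pk λ {e} e∈A pk⁻ → stuck (e , e∈A , pk⁻)
        F = proj₁ ∃F
        hall : Hall {t} A (λ _ → A)
        hall S = ≤-trans (+-cancelˡ-≤ (t * r) _ _ (begin
          t * r + ∣ S ∩ A ∣
            ≤⟨ +-monoˡ-≤ ∣ S ∩ A ∣ (pk (F ∪ (S ∩ A))) ⟩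
          t * rank M (F ∪ (S ∩ A)) + ∣ A ─ F ∪ (S ∩ A) ∣ + ∣ S ∩ A ∣
            ≡⟨ +-assoc (t * rank M (F ∪ (S ∩ A))) _ _ ⟩
          t * rank M (F ∪ (S ∩ A)) + (∣ A ─ F ∪ (S ∩ A) ∣ + ∣ S ∩ A ∣)
            ≤⟨ +-mono-≤ (≤-trans (*-monoʳ-≤ t (rank-∪ F (S ∩ A))) (≤-reflexive (*-distribˡ-+ t (rank M F) _)))
                 (∣u∣+∣v∣≤∣p∣ (λ x∈ → x∈p─q⇒x∉q A _ x∈ ∘ q⊆p∪q F (S ∩ A))
                   (λ x∈ → x∈p∧x∉q⇒x∈p─q (p─q⊆p A _ x∈) (x∈p─q⇒x∉q A _ x∈ ∘ p⊆p∪q (S ∩ A)))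
                   (λ x∈ → let x∈A = p∩q⊆q S A x∈ in x∈p∧x∉q⇒x∈p─q x∈A λ x∈F → proj₂ (proj₂ ∃F) x∈F x∈A)) ⟩
          t * rank M F + t * rank M (S ∩ A) + ∣ A ─ F ∣
            ≡⟨ trans (+-assoc (t * rank M F) _ _) (trans (cong (t * rank M F +_) (+-comm (t * rank M (S ∩ A)) _)) (sym (+-assoc (t * rank M F) _ _))) ⟩
          t * rank M F + ∣ A ─ F ∣ + t * rank M (S ∩ A)
            ≤⟨ +-monoˡ-≤ _ (proj₁ (proj₂ ∃F)) ⟩
          t * r + t * rank M (S ∩ A) ∎)) (≤-reflexive (sym (sum-const t _)))
        t*r≤∣A∣ : t * r ≤ ∣ A ∣
        t*r≤∣A∣ = begin
          t * r                     ≤⟨ pk ⊥ ⟩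
          t * rank M ⊥ + ∣ A ─ ⊥ ∣  ≡⟨ cong₂ (λ a X → t * a + ∣ X ∣) rank-⊥ (p─⊥≡p A) ⟩
          t * 0 + ∣ A ∣             ≡⟨ cong (_+ ∣ A ∣) (*-zeroʳ t) ⟩
          ∣ A ∣                     ∎
        open IndependentCover (hall⇒cover {t} A (λ _ → A) hall)

-- Rainbow bases

module _ {n k : ℕ} (M : Matroid n) (c : Fin n → Fin k) where

  -- Confinement to the union of the `B j` is what keeps bases found recursively disjoint from the
  -- one split off.
  RainbowBasesWithin : ∀ {t} → (Fin t → Subset n) → Set
  RainbowBasesWithin {t} B = ∃ λ (R : Fin t → Subset n) →
    (∀ i → IsBasis M (R i) × IsRainbow c (R i)) × Disjoint R × (∀ i {x} → x ∈ R i → ∃ λ j → x ∈ B j)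

  InjectiveOff : ∀ {t} → Subset n → (Fin t → Subset n) → Set
  InjectiveOff D B = ∀ i j x y → x ∈ B i → y ∈ B j → x ∉ D → y ∉ D → c x ≡ c y → x ≡ y

  rainbow-∷ : ∀ {t} {B : Fin (suc t) → Subset n} R (B′ : Fin t → Subset n) →
              IsBasis M R → IsRainbow c R → (∀ {x} → x ∈ R → ∃ λ j → x ∈ B j) →
              (∀ i {x} → x ∈ R → x ∉ B′ i) → (∀ i {x} → x ∈ B′ i → ∃ λ j → x ∈ B j) →
              RainbowBasesWithin B′ → RainbowBasesWithin B
  rainbow-∷ {t} {B} R B′ basis rainbow R⊆ disj B′⊆ (R′ , ok′ , disj′ , R′⊆) = Rs , ok , disjoint , within
    where
    Rs : Fin (suc t) → Subset n
    Rs zero = R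
    Rs (suc i) = R′ i
    ok : ∀ i → IsBasis M (Rs i) × IsRainbow c (Rs i)
    ok zero = basis , rainbow
    ok (suc i) = ok′ i
    R#R′ : ∀ i {x} → x ∈ R → x ∉ R′ i
    R#R′ i x∈R x∈R′ = let (j , x∈B′) = R′⊆ i x∈R′ in disj j x∈R x∈B′
    disjoint : Disjoint Rs
    disjoint zero zero 0≢0 = contradiction refl 0≢0
    disjoint zero (suc j) _ x x∈ x∈′ = R#R′ j x∈ x∈′
    disjoint (suc i) zero _ x x∈ x∈′ = R#R′ i x∈′ x∈
    disjoint (suc i) (suc j) i≢j = disj′ i j (i≢j ∘ cong suc)
    within : ∀ i {x} → x ∈ Rs i → ∃ λ j → x ∈ B j
    within zero = R⊆
    within (suc i) x∈ = let (j , x∈B′) = R′⊆ i x∈ in B′⊆ j x∈B′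

  -- Quantified over `B` and `D` because the induction on `t` changes both.
  RainbowPacking : ℕ → Set
  RainbowPacking t = (B : Fin t → Subset n) (D : Subset n) → (∀ i → IsBasis M (B i)) → Disjoint B →
                     ∣ D ∣ < t → InjectiveOff D B → RainbowBasesWithin B

  module Split {t : ℕ} (B : Fin (suc t) → Subset n) (D : Subset n) (basis : ∀ i → IsBasis M (B i)) (disj : Disjoint B)
               (D≤t : ∣ D ∣ ≤ t) (inj : InjectiveOff D B) (rest-packing : RainbowPacking t)
               (i : Fin (suc t)) (Bi∉D : ∀ {y} → y ∈ B i → y ∉ D) where

    Bi# : ∀ l {y} → y ∈ B i → y ∉ B (punchIn i l)
    Bi# l y∈ = disj i (punchIn i l) (punchInᵢ≢i i l ∘ sym) _ y∈

    rest# : ∀ l m → l ≢ m → ∀ {y} → y ∈ B (punchIn i l) → y ∉ B (punchIn i m)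
    rest# l m l≢m = disj _ _ (l≢m ∘ punchIn-injective i l m) _

    -- Outside `D` only `y` has the colour of `x`. Once `B i` is split off, `y` is gone and `x` need
    -- no longer be excluded.
    split-shared : ∀ x y → x ∈ D → y ∈ B i → c x ≡ c y → RainbowBasesWithin B
    split-shared x y x∈D y∈Bi cx≡cy = rainbow-∷ (B i) (B ∘ punchIn i) (basis i) Bi-rainbow (λ x∈ → i , x∈)
      Bi# (λ l x∈ → punchIn i l , x∈)
      (rest-packing (B ∘ punchIn i) (D - x) (basis ∘ punchIn i) (λ l m l≢m _ → rest# l m l≢m)
        (≤-trans (x∈p⇒∣p-x∣<∣p∣ x∈D) D≤t) inj′)
      where
      Bi-rainbow : IsRainbow c (B i)
      Bi-rainbow u v u∈ v∈ = inj i i u v u∈ v∈ (Bi∉D u∈) (Bi∉D v∈)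
      colour-x : ∀ l v → v ∈ B (punchIn i l) → v ∉ D → c v ≢ c x
      colour-x l v v∈ v∉D cv≡cx with inj _ i v y v∈ y∈Bi v∉D (Bi∉D y∈Bi) (trans cv≡cx cx≡cy)
      ... | refl = Bi# l y∈Bi v∈
      inj′ : InjectiveOff (D - x) (B ∘ punchIn i)
      inj′ l m u v u∈ v∈ u∉ v∉ cu≡cv with u ≟ x | v ≟ x
      ... | yes refl | yes refl = refl
      ... | yes refl | no v≢x = contradiction (sym cu≡cv) (colour-x m v v∈ λ v∈D → v∉ (x∈p∧x≢y⇒x∈p-y v∈D v≢x))
      ... | no u≢x | yes refl = contradiction cu≡cv (colour-x l u u∈ λ u∈D → u∉ (x∈p∧x≢y⇒x∈p-y u∈D u≢x))
      ... | no u≢x | no v≢x = inj _ _ u v u∈ v∈ (λ u∈D → u∉ (x∈p∧x≢y⇒x∈p-y u∈D u≢x))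
                                                (λ v∈D → v∉ (x∈p∧x≢y⇒x∈p-y v∈D v≢x)) cu≡cv

    no-surplus : (∀ l {y} → y ∈ B (punchIn i l) → y ∉ D) → RainbowBasesWithin B
    no-surplus rest∉D = B , (λ l → basis l , λ u v u∈ v∈ → inj l l u v u∈ v∈ (∉D l (i ≟ l) u∈) (∉D l (i ≟ l) v∈)) ,
                        disj , λ l x∈ → l , x∈
      where
      ∉D : ∀ l → Dec (i ≡ l) → ∀ {y} → y ∈ B l → y ∉ D
      ∉D l (yes refl) y∈ = Bi∉D y∈
      ∉D l (no i≢l) {y} y∈ = rest∉D (punchOut i≢l) (subst (λ m → y ∈ B m) (sym (punchIn-punchOut i≢l)) y∈)

    module _ (j : Fin t) {x : Fin n} (x∈D : x ∈ D) (x∈Bj : x ∈ B (punchIn i j)) (no-shared : ∀ {y} → y ∈ B i → c x ≢ c y)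
             {R C : Subset n} (R-basis : IsBasis M R) (C-basis : IsBasis M C) (x∈R : x ∈ R) (R⊆ : R ⊆ B i ∪ ⁅ x ⁆)
             (C⊆ : C ⊆ B i ∪ (B (punchIn i j) - x)) (R#C : ∀ {y} → y ∈ R → y ∉ C) where

      B′ : Fin t → Subset n
      B′ l = if does (l ≟ j) then C else B (punchIn i l)
      B′⁻ : ∀ l {y} → y ∈ B′ l → (l ≡ j × y ∈ C) ⊎ (l ≢ j × y ∈ B (punchIn i l))
      B′⁻ l y∈ with l ≟ j
      ... | yes l≡j = inj₁ (l≡j , y∈)
      ... | no l≢j = inj₂ (l≢j , y∈)
      B′-basis : ∀ l → IsBasis M (B′ l)
      B′-basis l with l ≟ j
      ... | yes _ = C-basis
      ... | no _ = basis (punchIn i l)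
      R⁻ : ∀ {y} → y ∈ R → y ∈ B i ⊎ y ≡ x
      R⁻ y∈ with x∈p∪q⁻ (B i) ⁅ x ⁆ (R⊆ y∈)
      ... | inj₁ y∈Bi = inj₁ y∈Bi
      ... | inj₂ y∈x = inj₂ (x∈⁅y⁆⇒x≡y x y∈x)
      C⁻ : ∀ {y} → y ∈ C → y ∈ B i ⊎ (y ∈ B (punchIn i j) × y ≢ x)
      C⁻ y∈ with x∈p∪q⁻ (B i) (B (punchIn i j) - x) (C⊆ y∈)
      ... | inj₁ y∈Bi = inj₁ y∈Bi
      ... | inj₂ y∈Bj-x = inj₂ (p─q⊆p _ ⁅ x ⁆ y∈Bj-x , x∈p-y⇒x≢y (B (punchIn i j)) y∈Bj-x)
      C# : ∀ l → l ≢ j → ∀ {y} → y ∈ C → y ∉ B (punchIn i l)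
      C# l l≢j y∈C y∈Bl with C⁻ y∈C
      ... | inj₁ y∈Bi = Bi# l y∈Bi y∈Bl
      ... | inj₂ (y∈Bj , _) = rest# l j l≢j y∈Bl y∈Bj
      R-rainbow : IsRainbow c R
      R-rainbow u v u∈ v∈ cu≡cv with R⁻ u∈ | R⁻ v∈
      ... | inj₁ u∈Bi | inj₁ v∈Bi = inj i i u v u∈Bi v∈Bi (Bi∉D u∈Bi) (Bi∉D v∈Bi) cu≡cv
      ... | inj₁ u∈Bi | inj₂ refl = contradiction (sym cu≡cv) (no-shared u∈Bi)
      ... | inj₂ refl | inj₁ v∈Bi = contradiction cu≡cv (no-shared v∈Bi)
      ... | inj₂ refl | inj₂ refl = refl
      R-within : ∀ {y} → y ∈ R → ∃ λ l → y ∈ B l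
      R-within y∈ with R⁻ y∈
      ... | inj₁ y∈Bi = i , y∈Bi
      ... | inj₂ refl = punchIn i j , x∈Bj
      R#B′ : ∀ l {y} → y ∈ R → y ∉ B′ l
      R#B′ l y∈R y∈B′ with B′⁻ l y∈B′ | R⁻ y∈R
      ... | inj₁ (_ , y∈C) | _ = R#C y∈R y∈C
      ... | inj₂ (_ , y∈Bl) | inj₁ y∈Bi = Bi# l y∈Bi y∈Bl
      ... | inj₂ (l≢j , y∈Bl) | inj₂ refl = rest# l j l≢j y∈Bl x∈Bj
      B′-within : ∀ l {y} → y ∈ B′ l → ∃ λ m → y ∈ B m
      B′-within l y∈ with B′⁻ l y∈
      ... | inj₂ (_ , y∈Bl) = punchIn i l , y∈Bl
      ... | inj₁ (_ , y∈C) with C⁻ y∈C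
      ...   | inj₁ y∈Bi = i , y∈Bi
      ...   | inj₂ (y∈Bj , _) = punchIn i j , y∈Bj
      B′≢x : ∀ l {y} → y ∈ B′ l → y ≢ x
      B′≢x l y∈ refl = R#B′ l x∈R y∈
      B′-disj : Disjoint B′
      B′-disj l m l≢m y y∈l y∈m with B′⁻ l y∈l | B′⁻ m y∈m
      ... | inj₁ (refl , _) | inj₁ (refl , _) = l≢m refl
      ... | inj₁ (refl , y∈C) | inj₂ (m≢j , y∈Bm) = C# m m≢j y∈C y∈Bm
      ... | inj₂ (l≢j , y∈Bl) | inj₁ (refl , y∈C) = C# l l≢j y∈C y∈Bl
      ... | inj₂ (_ , y∈Bl) | inj₂ (_ , y∈Bm) = rest# l m l≢m y∈Bl y∈Bm

      -- `R` takes `x` with it, so the remaining bases avoid `x` and `D - x` suffices for them. `R`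
      -- is rainbow, as its other elements come from `B i`, which misses `D` and the colour of `x`.
      split-exchanged : RainbowBasesWithin B
      split-exchanged = rainbow-∷ R B′ R-basis R-rainbow R-within R#B′ B′-within
        (rest-packing B′ (D - x) B′-basis B′-disj (≤-trans (x∈p⇒∣p-x∣<∣p∣ x∈D) D≤t)
          λ l m u v u∈ v∈ u∉ v∉ → inj _ _ u v (proj₂ (B′-within l u∈)) (proj₂ (B′-within m v∈))
            (λ u∈D → u∉ (x∈p∧x≢y⇒x∈p-y u∈D (B′≢x l u∈))) (λ v∈D → v∉ (x∈p∧x≢y⇒x∈p-y v∈D (B′≢x m v∈))))

    split : RainbowBasesWithin B
    split with any? (λ x → x ∈? D ×-dec any? λ y → y ∈? B i ×-dec (c x ≟ c y))
    ... | yes (x , x∈D , y , y∈Bi , cx≡cy) = split-shared x y x∈D y∈Bi cx≡cy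
    ... | no no-shared with any? (λ l → nonempty? (B (punchIn i l) ∩ D))
    ...   | no rest-misses-D = no-surplus λ l y∈ y∈D → rest-misses-D (l , _ , x∈p∩q⁺ (y∈ , y∈D))
    ...   | yes (j , x , x∈) =
      let (x∈Bj , x∈D) = x∈p∩q⁻ (B (punchIn i j)) D x∈
          (R , C , R-basis , C-basis , x∈R , R⊆ , C⊆ , R#C) = exchange M (basis i) (basis (punchIn i j)) (Bi# j) x∈Bj
      in split-exchanged j x∈D x∈Bj (λ y∈ eq → no-shared (x , x∈D , _ , y∈ , eq)) R-basis C-basis x∈R R⊆ C⊆ R#C

  rainbow-packing : ∀ t → RainbowPacking t
  -- For `t = 0` the bound on `∣ D ∣` is absurd. Otherwise `t` disjoint sets cannot all meet fewer
  -- than `t` elements, so some `B i` misses `D`. At a single basis `D` is empty, and the recursion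
  -- ends in `no-surplus`.
  rainbow-packing (suc t) B D basis disj D<t inj with any? (λ i → ¬? (nonempty? (B i ∩ D)))
  ... | no none = contradiction (disjoint⇒t*m≤∣X∣ (suc t) B D 1 disj λ i → nonempty⇒1≤ (B i ∩ D)
                    (decidable-stable (nonempty? (B i ∩ D)) λ empty → none (i , empty)))
                    (<⇒≱ (subst (∣ D ∣ <_) (sym (*-identityʳ (suc t))) D<t))
  ... | yes (i , empty) = Split.split B D basis disj (≤-pred D<t) inj (rainbow-packing t) i
                            λ y∈ y∈D → empty (_ , x∈p∩q⁺ (y∈ , y∈D))

module _ {n : ℕ} (M : Matroid n) (t : ℕ) (1≤t : 1 ≤ t) where

  r : ℕ
  r = rank M ⊤

  -- Upper bound: many colours force rainbow bases

  module _ {k : ℕ} (c : Fin n → Fin k)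
           -- Asked of all sets, since the tight set to which it is applied need not be a flat.
           (many : ∀ S → 2 + rank M S ≤ r → ∣ S ∣ + t * (r ∸ rank M S ∸ 1) < k) where

    Onto : Subset n → Set
    Onto A = ∀ j → ∃ λ x → x ∈ A × c x ≡ j

    Repeated : Subset n → Fin n → Set
    Repeated A e = e ∈ A × ∃ λ y → y ∈ A × y ≢ e × c y ≡ c e

    repeated? : ∀ A e → Dec (Repeated A e)
    repeated? A e = e ∈? A ×-dec any? λ y → y ∈? A ×-dec ¬? (y ≟ e) ×-dec (c y ≟ c e)

    onto-remove : ∀ {A e} → Onto A → Repeated A e → Onto (A - e)
    onto-remove {A} {e} onto (_ , y , y∈A , y≢e , cy≡ce) j with onto j
    ... | x , x∈A , cx≡j with x ≟ e
    ...   | yes refl = y , x∈p∧x≢y⇒x∈p-y y∈A y≢e , trans cy≡ce cx≡j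
    ...   | no x≢e = x , x∈p∧x≢y⇒x∈p-y x∈A x≢e , cx≡j

    module Stuck (A : Subset n) (onto : Onto A) (F : Subset n) (tight : Tight M t A F)
                 (unique : ∀ {e y} → e ∈ F → e ∈ A → y ∈ A → c y ≡ c e → y ≡ e) where

      rep : Fin k → Fin n
      rep j = proj₁ (onto j)

      rep∈A : ∀ j → rep j ∈ A
      rep∈A j = proj₁ (proj₂ (onto j))

      c-rep : ∀ j → c (rep j) ≡ j
      c-rep j = proj₂ (proj₂ (onto j))

      surplus? : ∀ x → Dec (x ∈ A × rep (c x) ≢ x)
      surplus? x = x ∈? A ×-dec ¬? (rep (c x) ≟ x)

      D : Subset n
      D = comprehension surplus?

      D⊆A : D ⊆ A
      D⊆A x∈D = proj₁ (∈-comprehension⁻ surplus? x∈D)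

      rep∉D : ∀ j → rep j ∉ D
      rep∉D j x∈D = proj₂ (∈-comprehension⁻ surplus? x∈D) (cong rep (c-rep j))

      ∉D⇒rep : ∀ {x} → x ∈ A → x ∉ D → rep (c x) ≡ x
      ∉D⇒rep {x} x∈A x∉D = decidable-stable (rep (c x) ≟ x) λ ne → x∉D (∈-comprehension⁺ surplus? (x∈A , ne))

      k≤∣A─D∣ : k ≤ ∣ A ─ D ∣
      k≤∣A─D∣ = injective⇒k≤∣X∣ rep (A ─ D)
        (λ {i} {j} eq → trans (sym (c-rep i)) (trans (cong c eq) (c-rep j)))
        λ j → x∈p∧x∉q⇒x∈p─q (rep∈A j) (rep∉D j)

      D⊆A─F : D ⊆ A ─ F
      D⊆A─F {x} x∈D = x∈p∧x∉q⇒x∈p─q (D⊆A x∈D) λ x∈F →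
        proj₂ (∈-comprehension⁻ surplus? x∈D) (unique x∈F (D⊆A x∈D) (rep∈A (c x)) (c-rep (c x)))

      -- One representative per colour lies in `A ─ D`, so `|D| + k` is at most `|F| + |A ─ F|`.
      -- Tightness bounds `|A ─ F|` by `t (r - r(F))`, and `many F` then leaves less than `t` for
      -- `D`.
      ∣D∣<t : ∣ D ∣ < t
      ∣D∣<t with 2 + rank M F ≤? r
      ... | yes le = +-cancelʳ-< k ∣ D ∣ t (begin-strict
          ∣ D ∣ + k                ≤⟨ +-monoʳ-≤ ∣ D ∣ k≤∣A─D∣ ⟩
          ∣ D ∣ + ∣ A ─ D ∣        ≤⟨ ∣u∣+∣v∣≤∣p∣ (λ x∈D x∈ → x∈p─q⇒x∉q A D x∈ x∈D) D⊆A (p─q⊆p A D) ⟩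
          ∣ A ∣                    ≤⟨ ∣u∣≤∣p∣+∣q∣ (p⊆q∪p─q A F) ⟩
          ∣ F ∣ + ∣ A ─ F ∣        ≤⟨ +-monoʳ-≤ ∣ F ∣ (+-cancelˡ-≤ (t * rank M F) _ _ (≤-trans tight (≤-reflexive t*r≡))) ⟩
          ∣ F ∣ + (t + t * d)      ≡⟨ cong (∣ F ∣ +_) (+-comm t _) ⟩
          ∣ F ∣ + (t * d + t)      ≡⟨ +-assoc ∣ F ∣ _ _ ⟨
          ∣ F ∣ + t * d + t        <⟨ +-monoˡ-< t (many F le) ⟩
          k + t                    ≡⟨ +-comm k t ⟩
          t + k                    ∎)
        where
        open ≤-Reasoning
        d = r ∸ rank M F ∸ 1
        r≡ : rank M F + suc d ≡ r
        r≡ = trans (cong (rank M F +_) (m+[n∸m]≡n (m+n≤o⇒m≤o∸n 1 (<⇒≤ le))))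
               (m+[n∸m]≡n (m+n≤o⇒n≤o 2 le))
        t*r≡ : t * r ≡ t * rank M F + (t + t * d)
        t*r≡ = trans (cong (t *_) (sym r≡)) (trans (*-distribˡ-+ t (rank M F) (suc d)) (cong (t * rank M F +_) (*-suc t d)))
      -- For `r(F) ≥ r - 1` the hypothesis `many` says nothing, but now `|A ─ F| ≤ t`. If `A ─ F`
      -- has an element, the representative of its colour is also outside `F`, so `D` is a proper
      -- subset.
      ... | no ¬le = small (nonempty? (A ─ F))
        where
        open ≤-Reasoning
        ∣A─F∣≤t : ∣ A ─ F ∣ ≤ t
        ∣A─F∣≤t = +-cancelˡ-≤ (t * rank M F) _ _ (begin
          t * rank M F + ∣ A ─ F ∣   ≤⟨ tight ⟩
          t * r                      ≤⟨ *-monoʳ-≤ t (≤-pred (≰⇒> ¬le)) ⟩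
          t * suc (rank M F)         ≡⟨ *-suc t _ ⟩
          t + t * rank M F           ≡⟨ +-comm t _ ⟩
          t * rank M F + t           ∎)
        small : Dec (Nonempty (A ─ F)) → ∣ D ∣ < t
        small (no empty) = ≤-trans (s≤s (≤-trans (p⊆q⇒∣p∣≤∣q∣ D⊆A─F)
          (≤-reflexive (empty⇒∣p∣≡0 empty)))) 1≤t
        small (yes (e , e∈)) = ≤-trans (p⊂q⇒∣p∣<∣q∣ (D⊆A─F , rep (c e) ,
          x∈p∧x∉q⇒x∈p─q (rep∈A (c e)) rep∉F , rep∉D (c e))) ∣A─F∣≤t
          where
          rep∉F : rep (c e) ∉ F
          rep∉F rep∈F = x∈p─q⇒x∉q A F e∈ (subst (_∈ F)
            (sym (unique rep∈F (rep∈A (c e)) (p─q⊆p A F e∈) (sym (c-rep (c e))))) rep∈F)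

      packable⇒rainbow : Packable M t A → HasDisjointRainbowBases M t c
      packable⇒rainbow pk =
        let (B , basis , B⊆ , disj) = pack M t A pk
            (R , ok , R-disj , _) = rainbow-packing M c t B D basis disj ∣D∣<t
              λ i j x y x∈ y∈ x∉D y∉D cx≡cy → trans (sym (∉D⇒rep (B⊆ i x∈) x∉D)) (trans (cong rep cx≡cy) (∉D⇒rep (B⊆ j y∈) y∉D))
        in R , ok , R-disj

    -- Each deleted element leaves its colour behind in `A`, so all `k` colours persist down to the
    -- stuck set.
    many-colours⇒rainbow : Packable M t ⊤ → Onto ⊤ → HasDisjointRainbowBases M t c
    many-colours⇒rainbow = go ⊤ (⊂-wellFounded ⊤)
      where
      go : ∀ A → Acc _⊂_ A → Packable M t A → Onto A → HasDisjointRainbowBases M t c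
      go A (acc rs) pk onto with any? (λ e → repeated? A e ×-dec packable? M t (A - e))
      ... | yes (e , rep , pk⁻) = go (A - e) (rs (x∈p⇒p-x⊂p (proj₁ rep))) pk⁻ (onto-remove onto rep)
      ... | no stuck =
        let (F , tight , F#) = ∃-tight-avoiding M t {A} (comprehension (repeated? A)) pk
              λ {e} e∈ pk⁻ → stuck (e , ∈-comprehension⁻ (repeated? A) e∈ , pk⁻)
        in Stuck.packable⇒rainbow A onto F tight
             (λ {e} {y} e∈F e∈A y∈A eq → decidable-stable (y ≟ e) λ y≢e →
               F# e∈F (∈-comprehension⁺ (repeated? A) (e∈A , y , y∈A , y≢e , eq))) pk

  -- Lower bounds: colourings without enough rainbow bases

  basis-outside : ∀ {B} → IsBasis M B → ∀ F → r ∸ rank M F ≤ ∣ B ∩ ∁ F ∣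
  basis-outside {B} isB F = m≤n+o⇒m∸n≤o r (rank M F) (begin
    r                              ≤⟨ basis⇒rank≤∣B∣ M isB ⟩
    ∣ B ∣                          ≤⟨ ∣u∣≤∣p∣+∣q∣ (p⊆p∩q∪p∩∁q B F) ⟩
    ∣ B ∩ F ∣ + ∣ B ∩ ∁ F ∣        ≤⟨ +-monoˡ-≤ _ (∣I∣≤rank M (indep-down M (proj₁ isB) (p∩q⊆p B F)) (p∩q⊆q B F)) ⟩
    rank M F + ∣ B ∩ ∁ F ∣         ∎)
    where
    open ≤-Reasoning

  sparse⇒good : SparseFlat M t → GoodColoring M t n
  sparse⇒good (F , _ , sparse) = id , (λ y → y , id) , λ (B , ok , disj) →
    <⇒≱ sparse (subst (t * (r ∸ rank M F) ≤_) (∣∁p∣≡n∸∣p∣ F)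
      (disjoint⇒t*m≤∣X∣ t B (∁ F) (r ∸ rank M F) disj λ i → basis-outside (proj₁ (ok i)) F))

  good⇒k≤n : ∀ k → GoodColoring M t k → k ≤ n
  good⇒k≤n k (c , surj , _) = subst (k ≤_) (∣⊤∣≡n n) (injective⇒k≤∣X∣ (proj₁ ∘ surj) ⊤
    (λ {i} {j} eq → trans (sym (proj₂ (surj i) refl)) (trans (cong c eq) (proj₂ (surj j) refl))) λ _ → ∈⊤)

  flatValue : Subset n → ℕ
  flatValue F = ∣ F ∣ + t * (r ∸ rank M F ∸ 1)

  -- F and W get private colours and everything else one common colour; a rainbow basis then
  -- has at least r(E) - r(F) - 1 elements in W.
  one-shared-colour : ∀ F W → W ⊆ ∁ F → let d = r ∸ rank M F ∸ 1 in suc d ≡ r ∸ rank M F →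
                      suc ∣ W ∣ ≡ t * d → t * d ≤ ∣ ∁ F ∣ → GoodColoring M t (flatValue F)
  one-shared-colour F W W⊆ r≡ suc∣W∣≡ t*d≤ = subst (GoodColoring M t) size (enumerate G , surjective , none)
    where
    open ≤-Reasoning
    d = r ∸ rank M F ∸ 1
    G = F ∪ W
    size : suc ∣ G ∣ ≡ flatValue F
    size = begin-equality
      suc ∣ G ∣            ≡⟨ cong suc (≤-antisym (∣u∣≤∣p∣+∣q∣ {u = G} {F} {W} id)
                                (∣u∣+∣v∣≤∣p∣ (λ x∈F x∈W → x∈∁p⇒x∉p (W⊆ x∈W) x∈F) (p⊆p∪q W) (q⊆p∪q F W))) ⟩
      suc (∣ F ∣ + ∣ W ∣)  ≡⟨ +-suc ∣ F ∣ ∣ W ∣ ⟨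
      ∣ F ∣ + suc ∣ W ∣    ≡⟨ cong (∣ F ∣ +_) suc∣W∣≡ ⟩
      ∣ F ∣ + t * d        ∎
    -- The common colour 0 must occur for surjectivity; it does because `W` is smaller than `∁ F`.
    ∃∉G : ∃ λ x → x ∉ G
    ∃∉G with nonempty? (∁ F ─ W)
    ... | yes (x , x∈) = x , λ x∈G → [ x∈∁p⇒x∉p (p─q⊆p (∁ F) W x∈) , x∈p─q⇒x∉q (∁ F) W x∈ ]′ (x∈p∪q⁻ F W x∈G)
    ... | no empty = contradiction (p⊆q⇒∣p∣≤∣q∣ ∁F⊆W) (<⇒≱ (≤-trans (≤-reflexive suc∣W∣≡) t*d≤))
      where
      ∁F⊆W : ∁ F ⊆ W
      ∁F⊆W {x} x∈ = decidable-stable (x ∈? W) λ x∉W → empty (x , x∈p∧x∉q⇒x∈p─q x∈ x∉W)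
    surjective : ∀ j → ∃ λ x → ∀ {z} → z ≡ x → enumerate G z ≡ j
    surjective zero = let (x , x∉G) = ∃∉G in x , λ { refl → ∉⇒enumerate≡0 G x∉G }
    surjective (suc j) = let (x , eq) = enumerate-onto G j in x , λ { refl → eq }
    none : ¬ HasDisjointRainbowBases M t (enumerate G)
    none (B , ok , disj) = <⇒≱ (≤-reflexive suc∣W∣≡) (disjoint⇒t*m≤∣X∣ t B W d disj λ i → ≤-pred (begin
      suc d                        ≡⟨ r≡ ⟩
      r ∸ rank M F                 ≤⟨ basis-outside (proj₁ (ok i)) F ⟩
      ∣ B i ∩ ∁ F ∣                ≤⟨ ∣u∣≤∣p∣+∣q∣ (p∩∁q⊆p─[q∪r]∪p∩r (B i) F W) ⟩
      ∣ B i ─ G ∣ + ∣ B i ∩ W ∣    ≤⟨ +-monoˡ-≤ _ (all-equal⇒∣p∣≤1 (B i ─ G) λ x∈ y∈ →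
                                        proj₂ (ok i) _ _ (p─q⊆p (B i) G x∈) (p─q⊆p (B i) G y∈)
                                          (trans (∉⇒enumerate≡0 G (x∈p─q⇒x∉q (B i) G x∈))
                                            (sym (∉⇒enumerate≡0 G (x∈p─q⇒x∉q (B i) G y∈))))) ⟩
      suc ∣ B i ∩ W ∣              ∎))

  -- The case without sparse flats

  module _ (¬sparse : ¬ SparseFlat M t) where

    flat-dense : ∀ F → IsFlat M F → t * (r ∸ rank M F) ≤ ∣ ∁ F ∣
    flat-dense F flat = subst (t * (r ∸ rank M F) ≤_) (sym (∣∁p∣≡n∸∣p∣ F)) (≮⇒≥ λ lt → ¬sparse (F , flat , lt))

    -- Passing from `S` to its closure keeps the rank and shrinks the complement, so density of
    -- flats is enough.
    packable-⊤ : Packable M t ⊤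
    packable-⊤ S = let (F , S⊆F , eq , flat) = ∃-closure M S in begin
      t * r                                     ≤⟨ *-monoʳ-≤ t (m≤n+m∸n r (rank M F)) ⟩
      t * (rank M F + (r ∸ rank M F))           ≡⟨ *-distribˡ-+ t (rank M F) _ ⟩
      t * rank M F + t * (r ∸ rank M F)         ≤⟨ +-mono-≤ (≤-reflexive (cong (t *_) eq)) (≤-trans (flat-dense F flat)
                                                     (p⊆q⇒∣p∣≤∣q∣ λ x∈ → x∈p∧x∉q⇒x∈p─q ∈⊤ (x∈∁p⇒x∉p x∈ ∘ S⊆F))) ⟩
      t * rank M S + ∣ ⊤ ─ S ∣                  ∎
      where open ≤-Reasoning

    good⇒k≤m : ∀ {m} → (∀ F → IsFlat M F → rank M F ≤ r ∸ 2 → flatValue F ≤ m) → ∀ k → GoodColoring M t k → k ≤ m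
    good⇒k≤m {m} max k (c , surj , none) with k ≤? m
    ... | yes le = le
    ... | no ¬le = contradiction (many-colours⇒rainbow c many packable-⊤ λ j → let (x , eq) = surj j in x , ∈⊤ , eq refl) none
      where
      open ≤-Reasoning
      many : ∀ S → 2 + rank M S ≤ r → flatValue S < k
      -- The closure has the same rank and at least as many elements, so its value dominates that of
      -- `S`.
      many S le = let (F , S⊆F , eq , flat) = ∃-closure M S in begin-strict
        ∣ S ∣ + t * (r ∸ rank M S ∸ 1)    ≡⟨ cong (λ a → ∣ S ∣ + t * (r ∸ a ∸ 1)) eq ⟨
        ∣ S ∣ + t * (r ∸ rank M F ∸ 1)    ≤⟨ +-monoˡ-≤ _ (p⊆q⇒∣p∣≤∣q∣ S⊆F) ⟩
        flatValue F                       ≤⟨ max F flat (≤-trans (≤-reflexive eq) (∸-monoˡ-≤ 2 le)) ⟩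
        m                                 <⟨ ≰⇒> ¬le ⟩
        k                                 ∎

    flat⇒good : 2 ≤ r → ∀ F → IsFlat M F → rank M F ≤ r ∸ 2 → GoodColoring M t (flatValue F)
    flat⇒good 2≤r F flat le =
      -- `W` is one element short of the `t * d` that the rainbow bases would need.
      let (W , W⊆ , ∣W∣≡q) = ∃-subset-of-size (t * d ∸ 1) (∁ F) (≤-trans (m∸n≤m _ 1) t*d≤∣∁F∣)
      in one-shared-colour F W W⊆ r≡ (trans (cong suc ∣W∣≡q) (m+[n∸m]≡n 1≤t*d)) t*d≤∣∁F∣
      where
      d = r ∸ rank M F ∸ 1
      2+rF≤r : 2 + rank M F ≤ r
      -- `2 ≤ r` makes the truncated `r ∸ 2` a true difference. Hence `d` is positive, and so is
      -- `t * d`, from which 1 is subtracted.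
      2+rF≤r = ≤-trans (+-monoʳ-≤ 2 le) (≤-reflexive (m+[n∸m]≡n 2≤r))
      r≡ : suc d ≡ r ∸ rank M F
      r≡ = m+[n∸m]≡n (m+n≤o⇒m≤o∸n 1 (<⇒≤ 2+rF≤r))
      1≤t*d : 1 ≤ t * d
      1≤t*d = *-mono-≤ 1≤t (≤-pred (≤-trans (m+n≤o⇒m≤o∸n 2 2+rF≤r) (≤-reflexive (sym r≡))))
      t*d≤∣∁F∣ : t * d ≤ ∣ ∁ F ∣
      t*d≤∣∁F∣ = ≤-trans (*-monoʳ-≤ t (m∸n≤m _ 1)) (flat-dense F flat)

  -- Existence of the maximum

  isFlat? : ∀ F → Dec (IsFlat M F)
  isFlat? F = all? λ x → (rank M (F ∪ ⁅ x ⁆) ≟ℕ rank M F) →-dec x ∈? F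

  -- The closure of `⊥` has rank 0, so there is a flat to start from; `n + t * r` is a crude bound
  -- on all values.
  ∃-maxFlatValue : ∃ (MaxFlatValue M t)
  ∃-maxFlatValue =
    let (F₀ , _ , eq , flat₀) = ∃-closure M ⊥
        (F , (flat , le) , max) = argmax (λ F → isFlat? F ×-dec (rank M F ≤? r ∸ 2)) flatValue (n + t * r)
          (λ S → +-mono-≤ (∣p∣≤n S) (*-monoʳ-≤ t (≤-trans (m∸n≤m _ 1) (m∸n≤m r (rank M S)))))
          (F₀ , flat₀ , ≤-trans (≤-reflexive (trans eq (rank-⊥ M))) z≤n)
    in flatValue F , (F , flat , le , refl) , λ G flatG leG → max G (flatG , leG)

theorem3 : (n : ℕ) (M : Matroid n) (t : ℕ) → 1 ≤ t → 2 ≤ rank M ⊤ →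
    (SparseFlat M t → ArIs M t n) ×
    (¬ SparseFlat M t → ∃ λ m → MaxFlatValue M t m × ArIs M t m)
theorem3 n M t 1≤t 2≤r = (λ sparse → sparse⇒good M t 1≤t sparse , good⇒k≤n M t 1≤t) , dense
  where
  dense : ¬ SparseFlat M t → ∃ λ m → MaxFlatValue M t m × ArIs M t m
  dense ¬sparse with ∃-maxFlatValue M t 1≤t
  ... | m , isMax@((F , flat , le , refl) , max) =
    m , isMax , flat⇒good M t 1≤t ¬sparse 2≤r F flat le , good⇒k≤m M t 1≤t ¬sparse max
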